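{- The three-color Ramsey number of the path $P_8$ satisfies $R_3(P_8) = 14$.
   Context: All graphs are undirected, finite, with no loops or multiple edges. $P_k$ denotes the path on $k$ vertices, and $K_N$ denotes the complete graph on $N$ vertices. For a graph $G$, the three-color diagonal Ramsey number $R_3(G) = R(G,G,G)$ is the smallest integer $N$ such that every coloring of the edges of $K_N$ with 3 colors contains a monochromatic copy of $G$ (as a not necessarily induced subgraph), i.e. there is a color $i \in \{1,2,3\}$ such that the graph formed by the edges of color $i$ contains a subgraph isomorphic to $G$. -}

module Defs where

open import Data.Fin using (Fin; toℕ)
open import Data.Nat using (ℕ; suc; _≤_)
open import Data.Nat.Properties using (1+n≢n)
open import Data.Product using (Σ; _×_; _,_; ∃-syntax)
open import Data.Sum using (_⊎_; inj₁; inj₂; swap)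
open import Function.Definitions using (Injective)
open import Level using (0ℓ)
open import Relation.Binary.Core using (Rel; _Preserves_⟶_)
open import Relation.Binary.Definitions using (Symmetric; Irreflexive)
open import Relation.Binary.PropositionalEquality
  using (_≡_; _≢_; refl; sym; trans; ≢-sym)

record Graph (n : ℕ) : Set₁ where
  field
    Adj        : Rel (Fin n) 0ℓ
    adj-sym    : Symmetric Adj
    adj-irrefl : Irreflexive _≡_ Adj

open Graph public

path : (n : ℕ) → Graph n
path n .Adj u v = toℕ v ≡ suc (toℕ u) ⊎ toℕ u ≡ suc (toℕ v)
path n .adj-sym = swap
path n .adj-irrefl refl (inj₁ eq) = 1+n≢n (sym eq)
path n .adj-irrefl refl (inj₂ eq) = 1+n≢n (sym eq)

complete : (n : ℕ) → Graph n
complete n .Adj u v = u ≢ v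
complete n .adj-sym = ≢-sym
complete n .adj-irrefl u≡v u≢v = u≢v u≡v

-- A copy of G in H, not necessarily induced: non-adjacent vertices of G
-- may be sent to adjacent vertices of H.
_⊑_ : ∀ {m n} → Graph m → Graph n → Set
_⊑_ {m} {n} G H =
  Σ (Fin m → Fin n) λ f → Injective _≡_ _≡_ f × f Preserves Adj G ⟶ Adj H

-- colour-sym quantifies over both adjacency proofs, so (using adj-sym) the
-- colour depends only on the unordered pair {u , v}, not on the proof.
record EdgeColouring {n : ℕ} (H : Graph n) (k : ℕ) : Set where
  field
    colour     : ∀ {u v} → Adj H u v → Fin k
    colour-sym : ∀ {u v} (e : Adj H u v) (e′ : Adj H v u) → colour e ≡ colour e′

open EdgeColouring public

colourClass : ∀ {n k} {H : Graph n} → EdgeColouring H k → Fin k → Graph n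
colourClass {H = H} c i .Adj u v = Σ (Adj H u v) λ e → colour c e ≡ i
colourClass {H = H} c i .adj-sym (e , eq) =
  adj-sym H e , trans (colour-sym c (adj-sym H e) e) eq
colourClass {H = H} c i .adj-irrefl u≡v (e , _) = adj-irrefl H u≡v e

Forces : ∀ {m} → ℕ → ℕ → Graph m → Set
Forces k N G = (c : EdgeColouring (complete N) k) → ∃[ i ] G ⊑ colourClass c i

-- R(G, …, G) = N, with k arguments G.  This is a relation because defining R as
-- a function would require a proof of Ramsey's theorem.
IsRamseyNumber : ∀ {m} → ℕ → Graph m → ℕ → Set
IsRamseyNumber k G N = Forces k N G × (∀ M → Forces k M G → N ≤ M)

{-# OPTIONS --safe #-}
-- Suppose that a 3-colouring of K₁₄ has no monochromatic P₈. A graph on n vertices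
-- without P₈, C₆ and C₇ has at most 2n edges, since a longest path in it yields k > 0
-- vertices that meet at most 2k edges. As 91 > 3 · 28, some colour, say red, has a C₆
-- or a C₇.
--
-- If no edge between disjoint vertex sets of sizes 7 and 7, or 6 and 8, is red, then
-- there is a monochromatic P₈: consider the majority colour at each vertex of the first
-- set, and note that three vertices with at least four blue neighbours each among seven
-- columns lie on blue P₇s with at least four different ends. This excludes a red C₇, and
-- around a red C₆ it leaves only the case that every red edge meets a set S of three
-- vertices or lies inside Q or inside Z, where |Q| = 3, |Z| ≤ 5 and no red edge leaves Z.
-- Then red has so few edges that a second colour has more than 2n edges on V ∖ S or
-- on V, hence a C₆ and the same structure. Two such structures force a P₈ in the third colour.
--
-- Finite parts of the argument are checked by evaluation, over all numbers of vertices
-- of each kind.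
--
-- For the lower bound, blow up the 1-factorization of K₄ with parts of sizes 3, 3, 3, 4.
module Submission where

open import Defs
open import Data.Bool using (Bool; true; false; T; _∧_; _∨_; _xor_; if_then_else_) renaming (_≟_ to _≟ᵇ_)
open import Data.Bool.ListAction using (any)
open import Data.Bool.Properties using (T-∧; xor-comm)
open import Data.Empty using (⊥; ⊥-elim)
open import Data.Fin using (Fin; zero; suc; #_; toℕ; inject₁)
import Data.Fin.Properties as Fin
open import Data.List using (List; []; _∷_; _++_; _∷ʳ_; length; filter; filterᵇ; map; take; concat; allFin; tabulate; lookup; upTo)
open import Data.List.Properties
  using (length-++; length-take; length-tabulate; length-map; map-++; map-tabulate; ++-assoc; ++-identityʳ; filter-all; filter-accept)
open import Data.List.Membership.Propositional using (_∈_; _∉_; find; lose)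
open import Data.List.Membership.Propositional.Properties
  using (∈-∃++; ∈-++⁺ˡ; ∈-++⁺ʳ; ∈-++⁻; ∈-allFin; ∈-filter⁺; ∈-filter⁻; ∈-lookup; ∈-concat⁺′; ∈-concat⁻′; ∈-map⁺; ∈-map⁻; ∈-tabulate⁻; ∈-upTo⁺)
import Data.List.Membership.DecPropositional as DecMembership
open import Data.List.Relation.Binary.Disjoint.Propositional using (Disjoint)
open import Data.List.Relation.Binary.Permutation.Propositional
  using (_↭_; ↭-refl; ↭-sym; ↭-trans; ↭-reflexive; prep; swap; ↭⇒↭ₛ)
open import Data.List.Relation.Binary.Permutation.Propositional.Properties
  using (shift; ↭-length; ∈-resp-↭; ++⁺; ++⁺ˡ; ++⁺ʳ; ++-comm; filter-↭)
import Data.List.Relation.Binary.Permutation.Setoid.Properties as ↭ₛ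
open import Data.List.Relation.Binary.Subset.Propositional using (_⊆_)
open import Data.List.Relation.Unary.All as All using (All; []; _∷_)
import Data.List.Relation.Unary.All.Properties as All
open import Data.List.Relation.Unary.AllPairs as AllPairs using ([]; _∷_)
import Data.List.Relation.Unary.AllPairs.Properties as AllPairs
open import Data.List.Relation.Unary.Any using (Any; here; there; any?; index)
open import Data.List.Relation.Unary.Any.Properties using (any⁻; lookup-index)
open import Data.List.Relation.Unary.Linked using (Linked; []; [-]; _∷_)
open import Data.List.Relation.Unary.Unique.Propositional using (Unique)
open import Data.List.Relation.Unary.Unique.Propositional.Properties as Unique
  using (Unique[x∷xs]⇒x∉xs; allFin⁺)
import Data.List.Relation.Unary.Unique.DecPropositional as DecUnique
open import Data.Nat using (ℕ; zero; suc; _+_; _*_; _∸_; _≤_; _<_; _≤ᵇ_; _<ᵇ_; z≤n; s≤s)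
open import Data.Nat.ListAction using (sum)
import Data.Nat.Properties as ℕ
open import Data.Nat.Tactic.RingSolver using (solve-∀)
open import Data.Product using (∃; _×_; _,_; proj₁; proj₂)
open import Data.Sum using (_⊎_; inj₁; inj₂; [_,_]′)
open import Data.Unit using (tt)
open import Data.Vec as Vec using (Vec; []; _∷_; _[_]≔_)
import Data.Vec.Properties as Vec
open import Function using (_∘_; case_of_; Equivalence)
open import Relation.Binary.PropositionalEquality
open import Relation.Binary.PropositionalEquality.Properties using (setoid)
open import Relation.Nullary using (¬_; Dec; yes; no; does; True; ¬?; _→-dec_)
open import Relation.Nullary.Decidable using (T?; toWitness; map′; _×-dec_; decidable-stable)

-- The factor 2 in the edge bound is dictated by K₅, which attains it. K₆ and K₇ contain no P₈
-- either but exceed it: two disjoint copies of K₇ have 42 edges, so counting alone cannot succeed,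
-- and C₆ and C₇ call for structural arguments. A C₇ leaves seven vertices outside and a C₆ leaves
-- eight. Since a cycle of such length with little attached to it already contains a P₈, hardly any
-- red edges leave it, and this is where large bipartite graphs without red come from. Colourings
-- are too many to be enumerated, so the finite checks work in a quotient. Vertices are sorted into
-- classes such that the classes of two vertices decide whether an edge of the desired colour is
-- guaranteed, and only the sizes of the classes are enumerated. A path found from the sizes lifts
-- to the vertices, as all members of a class are interchangeable.

module _ {A : Set} where

  -- Lists without repetitions.

  ∈⇒↭ : ∀ {x : A} {xs} → x ∈ xs → ∃ λ ys → xs ↭ x ∷ ys
  ∈⇒↭ {x} x∈xs with ys , zs , refl ← ∈-∃++ x∈xs = ys ++ zs , shift x ys zs

  Unique-resp-↭ : ∀ {xs ys : List A} → xs ↭ ys → Unique xs → Unique ys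
  Unique-resp-↭ xs↭ys = ↭ₛ.Unique-resp-↭ (setoid A) (↭⇒↭ₛ xs↭ys)

  ∷-Unique : ∀ {x : A} {xs} → x ∉ xs → Unique xs → Unique (x ∷ xs)
  ∷-Unique x∉xs xs! = All.¬Any⇒All¬ _ x∉xs ∷ xs!

  Unique-tail : ∀ {x : A} {xs} → Unique (x ∷ xs) → Unique xs
  Unique-tail (_ ∷ xs!) = xs!

  Unique-++⁻ʳ : ∀ (xs : List A) {ys} → Unique (xs ++ ys) → Unique ys
  Unique-++⁻ʳ []       u = u
  Unique-++⁻ʳ (x ∷ xs) u = Unique-++⁻ʳ xs (Unique-tail u)

  Unique-++⁻ˡ : ∀ (xs : List A) {ys} → Unique (xs ++ ys) → Unique xs
  Unique-++⁻ˡ []       u       = []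
  Unique-++⁻ˡ (x ∷ xs) u@(_ ∷ u′) =
    ∷-Unique (λ x∈xs → Unique[x∷xs]⇒x∉xs u (∈-++⁺ˡ x∈xs)) (Unique-++⁻ˡ xs u′)

  Unique-++⇒Disjoint : ∀ (xs : List A) {ys} → Unique (xs ++ ys) → Disjoint xs ys
  Unique-++⇒Disjoint (x ∷ xs) u (here refl , v∈ys) =
    Unique[x∷xs]⇒x∉xs u (∈-++⁺ʳ xs v∈ys)
  Unique-++⇒Disjoint (x ∷ xs) (_ ∷ u) (there v∈xs , v∈ys) =
    Unique-++⇒Disjoint xs u (v∈xs , v∈ys)

  lookup-injective : ∀ {xs : List A} → Unique xs → ∀ {i j} → lookup xs i ≡ lookup xs j → i ≡ j
  lookup-injective {_ ∷ _}  _       {zero}  {zero}  _  = refl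
  lookup-injective {_ ∷ xs} u       {zero}  {suc j} eq =
    ⊥-elim (Unique[x∷xs]⇒x∉xs u (subst (_∈ xs) (sym eq) (∈-lookup j)))
  lookup-injective {_ ∷ xs} u       {suc i} {zero}  eq =
    ⊥-elim (Unique[x∷xs]⇒x∉xs u (subst (_∈ xs) eq (∈-lookup i)))
  lookup-injective {_ ∷ _}  (_ ∷ u) {suc i} {suc j} eq = cong suc (lookup-injective u eq)

  ∈-∷⁻ : ∀ {x y : A} {xs} → x ∈ y ∷ xs → x ≡ y ⊎ x ∈ xs
  ∈-∷⁻ (here eq) = inj₁ eq
  ∈-∷⁻ (there x∈xs) = inj₂ x∈xs

  Unique-⊆⇒↭ : ∀ {xs ys : List A} → Unique xs → xs ⊆ ys → ∃ λ zs → ys ↭ xs ++ zs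
  Unique-⊆⇒↭ {[]} {ys} _ _ = ys , ↭-refl
  Unique-⊆⇒↭ {x ∷ xs} u@(_ ∷ xs!) s
    with ys′ , ys↭ ← ∈⇒↭ (s (here refl))
    with zs , ys′↭ ← Unique-⊆⇒↭ {xs} {ys′} xs! (λ v∈xs →
           [ (λ { refl → ⊥-elim (Unique[x∷xs]⇒x∉xs u v∈xs) }) , (λ v∈ys′ → v∈ys′) ]′
             (∈-∷⁻ (∈-resp-↭ ys↭ (s (there v∈xs)))))
    = zs , ↭-trans ys↭ (prep x ys′↭)

  Unique-⊆⇒length≤ : ∀ {xs ys : List A} → Unique xs → xs ⊆ ys → length xs ≤ length ys
  Unique-⊆⇒length≤ {xs} {ys} u s with zs , p ← Unique-⊆⇒↭ u s =
    subst (length xs ≤_) (sym (trans (↭-length p) (length-++ xs)))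
      (ℕ.m≤m+n (length xs) (length zs))

  Unique-⊆-length≥⇒↭ : ∀ {xs ys : List A} → Unique xs → xs ⊆ ys → length ys ≤ length xs → ys ↭ xs
  Unique-⊆-length≥⇒↭ {xs} u s ys≤xs with Unique-⊆⇒↭ u s
  ... | [] , p = ↭-trans p (↭-reflexive (++-identityʳ xs))
  ... | z ∷ zs , p = ⊥-elim (ℕ.m+1+n≰m (length xs)
    (subst (_≤ length xs) (trans (↭-length p) (length-++ xs)) ys≤xs))

  take-⊆ : ∀ n (xs : List A) → take n xs ⊆ xs
  take-⊆ (suc n) (x ∷ xs) (here eq)   = here eq
  take-⊆ (suc n) (x ∷ xs) (there x∈)  = there (take-⊆ n xs x∈)

  length-take-≤ : ∀ {n} {xs : List A} → n ≤ length xs → length (take n xs) ≡ n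
  length-take-≤ {n} {xs} n≤ = trans (length-take n xs) (ℕ.m≤n⇒m⊓n≡m n≤)

filter-¬-↭ : ∀ {A : Set} {P : A → Set} (P? : ∀ x → Dec (P x)) xs →
             xs ↭ filter P? xs ++ filter (λ x → ¬? (P? x)) xs
filter-¬-↭ P? [] = ↭-refl
filter-¬-↭ P? (x ∷ xs) with P? x
... | yes _ = prep x (filter-¬-↭ P? xs)
... | no _  = ↭-trans (prep x (filter-¬-↭ P? xs)) (↭-sym (shift x (filter P? xs) _))

length-filter-¬ : ∀ {A : Set} {P : A → Set} (P? : ∀ x → Dec (P x)) xs →
                  length xs ≡ length (filter P? xs) + length (filter (λ x → ¬? (P? x)) xs)
length-filter-¬ P? xs = trans (↭-length (filter-¬-↭ P? xs)) (length-++ (filter P? xs))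

covering⇒≤length : ∀ {n} {xs : List (Fin n)} → (∀ v → v ∈ xs) → n ≤ length xs
covering⇒≤length {n} {xs} cover =
  subst (_≤ length xs) (length-tabulate (λ x → x))
    (Unique-⊆⇒length≤ (allFin⁺ n) (λ {v} _ → cover v))

-- Searching for paths by class sizes.

-- c k is the number of unused vertices of class k. A walk never visits a class more
-- often than that, and n counts its steps, so that it visits n + 1 vertices.
module Walks {m : ℕ} (compatible : Fin m → Fin m → Bool) where

  walk : ℕ → Fin m → Vec ℕ m → Bool
  visit : ℕ → Fin m → ℕ → Vec ℕ m → Bool
  walk zero    a c = true
  walk (suc n) a c =
    any (λ b → compatible a b ∧ visit n b (Vec.lookup c b) c) (allFin m)
  visit n b zero    c = false
  visit n b (suc k) c = walk n b (c [ b ]≔ k)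

  walkFrom : ℕ → Vec ℕ m → Fin m → Bool
  walkFrom n c a = visit n a (Vec.lookup c a) c

  walkSomewhere : ℕ → Vec ℕ m → Bool
  walkSomewhere n c = any (walkFrom n c) (allFin m)

module _ {A : Set} where

  join : ∀ {m} → Vec (List A) m → List A
  join []         = []
  join (xs ∷ xss) = xs ++ join xss

  ∈-join⁺ : ∀ {m} (xss : Vec (List A) m) k {x} → x ∈ Vec.lookup xss k → x ∈ join xss
  ∈-join⁺ (xs ∷ xss) zero    x∈ = ∈-++⁺ˡ x∈
  ∈-join⁺ (xs ∷ xss) (suc k) x∈ = ∈-++⁺ʳ xs (∈-join⁺ xss k x∈)

  join-remove : ∀ {m} (xss : Vec (List A) m) k {x ys} → Vec.lookup xss k ↭ x ∷ ys →
                join xss ↭ x ∷ join (xss [ k ]≔ ys)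
  join-remove (xs ∷ xss) zero    p = ++⁺ʳ (join xss) p
  join-remove (xs ∷ xss) (suc k) {x} {ys} p =
    ↭-trans (++⁺ˡ xs (join-remove xss k p)) (shift x xs (join (xss [ k ]≔ ys)))

module WalkSoundness
  {A : Set} {m : ℕ} (compatible : Fin m → Fin m → Bool)
  (Class : Fin m → A → Set) (E : A → A → Set)
  (E-sound : ∀ {a b x y} → T (compatible a b) → Class a x → Class b y → E x y)
  where

  open Walks compatible

  Path : ℕ → A → List A → Set
  Path n x ys = ∃ λ p → length p ≡ n × Linked E (x ∷ p) × Unique (x ∷ p) × x ∷ p ⊆ ys

  _Fits_ : Vec ℕ m → Vec (List A) m → Set
  c Fits xss = ∀ k → Vec.lookup c k ≤ length (Vec.lookup xss k)

  Classified : Vec (List A) m → Set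
  Classified xss = ∀ k {x} → x ∈ Vec.lookup xss k → Class k x

  visit-nonempty : ∀ n a k c {xs : List A} → T (visit n a k c) → k ≤ length xs → ∃ (_∈ xs)
  visit-nonempty n a (suc k) c {x ∷ _} _ _ = x , here refl

  walkFrom-sound : ∀ n c a → T (walkFrom n c a) → ∀ xss → c Fits xss → Classified xss →
                   Unique (join xss) → ∀ {x} → x ∈ Vec.lookup xss a → Path n x (join xss)
  walkFrom-sound n c a t xss fits cl xss! {x} x∈ with Vec.lookup c a in eq
  walkFrom-sound zero c a t xss fits cl xss! {x} x∈ | suc k =
    [] , refl , [-] , [] ∷ [] , λ { (here refl) → ∈-join⁺ xss a x∈ }
  walkFrom-sound (suc n) c a t xss fits cl xss! {x} x∈ | suc k =
    extend (find (any⁻ (λ b → compatible a b ∧ visit n b (Vec.lookup c′ b) c′) (allFin m) t))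
    where
    c′ = c [ a ]≔ k
    ys = proj₁ (∈⇒↭ x∈)
    x∷ys↭ = proj₂ (∈⇒↭ x∈)
    xss′ = xss [ a ]≔ ys
    join↭ = join-remove xss a x∷ys↭
    fits′ : c′ Fits xss′
    fits′ b with b Fin.≟ a
    ... | yes refl rewrite Vec.lookup∘update a c k | Vec.lookup∘update a xss ys =
      ℕ.≤-pred (subst₂ _≤_ eq (↭-length x∷ys↭) (fits a))
    ... | no b≢a rewrite Vec.lookup∘update′ b≢a c k
                       | Vec.lookup∘update′ b≢a xss ys = fits b
    cl′ : Classified xss′
    cl′ b y∈ with b Fin.≟ a
    ... | yes refl rewrite Vec.lookup∘update a xss ys =
      cl a (∈-resp-↭ (↭-sym x∷ys↭) (there y∈))
    ... | no b≢a rewrite Vec.lookup∘update′ b≢a xss ys = cl b y∈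
    x∷xss′! = Unique-resp-↭ join↭ xss!
    extend : (∃ λ b → b ∈ allFin m × T (compatible a b ∧ visit n b (Vec.lookup c′ b) c′)) →
             Path (suc n) x (join xss)
    extend (b , _ , t′)
      with ab , w ← Equivalence.to T-∧ t′
      with y , y∈ ← visit-nonempty n b (Vec.lookup c′ b) c′ w (fits′ b)
      with p , len , link , p! , p⊆ ← walkFrom-sound n c′ b w xss′ fits′ cl′ (Unique-tail x∷xss′!) y∈
      = y ∷ p , cong suc len , E-sound ab (cl a x∈) (cl′ b y∈) ∷ link
      , ∷-Unique (λ x∈p → Unique[x∷xs]⇒x∉xs x∷xss′! (p⊆ x∈p)) p!
      , λ { (here refl) → ∈-join⁺ xss a x∈
          ; (there z∈) → ∈-resp-↭ (↭-sym join↭) (there (p⊆ z∈)) }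

  walkSomewhere-sound : ∀ n c → T (walkSomewhere n c) → ∀ xss → c Fits xss →
                        Classified xss → Unique (join xss) →
                        ∃ λ p → length p ≡ suc n × Linked E p × Unique p × p ⊆ join xss
  walkSomewhere-sound n c t xss fits cl xss!
    with a , _ , w ← find (any⁻ (walkFrom n c) (allFin m) t)
    with x , x∈ ← visit-nonempty n a (Vec.lookup c a) c w (fits a)
    with p , len , link , p! , p⊆ ← walkFrom-sound n c a w xss fits cl xss! x∈
    = x ∷ p , cong suc len , link , p! , p⊆

-- Sizes of classes.

total : ∀ {m} → (Fin m → Bool) → Vec ℕ m → ℕ
total p c = sum (map (Vec.lookup c) (filterᵇ p (allFin _)))

total-true : ∀ {m} (c : Vec ℕ m) → total (λ _ → true) c ≡ Vec.sum c
total-true {m} c = trans (cong (sum ∘ map (Vec.lookup c)) (filter-all (λ _ → T? true) (All.universal (λ _ → tt) (allFin m))))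
  (trans (cong sum (map-tabulate (λ i → i) (Vec.lookup c))) (sum-tabulate c))
  where
  sum-tabulate : ∀ {n} (d : Vec ℕ n) → sum (tabulate (Vec.lookup d)) ≡ Vec.sum d
  sum-tabulate []      = refl
  sum-tabulate (k ∷ d) = cong (k +_) (sum-tabulate d)

module Classes {A : Set} {m : ℕ} (label : A → Fin m) (xs : List A) where

  class : Fin m → List A
  class k = filter (λ x → label x Fin.≟ k) xs

  classes : Vec (List A) m
  classes = Vec.tabulate class

  sizes : Vec ℕ m
  sizes = Vec.tabulate (length ∘ class)

  ∈-classes⁻ : ∀ k {x} → x ∈ Vec.lookup classes k → x ∈ xs × label x ≡ k
  ∈-classes⁻ k x∈ rewrite Vec.lookup∘tabulate class k = ∈-filter⁻ (λ x → label x Fin.≟ k) x∈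

  sizes-fit : ∀ k → Vec.lookup sizes k ≤ length (Vec.lookup classes k)
  sizes-fit k rewrite Vec.lookup∘tabulate class k | Vec.lookup∘tabulate (length ∘ class) k = ℕ.≤-refl

  module _ (xs! : Unique xs) where

    concat-classes-! : ∀ {ks} → Unique ks → Unique (concat (map class ks))
    concat-classes-! ks! = Unique.concat⁺
      (All.map⁺ (All.universal (λ k → Unique.filter⁺ (λ x → label x Fin.≟ k) xs!) _))
      (AllPairs.map⁺ (AllPairs.map disjoint ks!))
      where
      disjoint : ∀ {k l} → k ≢ l → Disjoint (class k) (class l)
      disjoint {k} {l} k≢l (x∈k , x∈l) =
        k≢l (trans (sym (proj₂ (∈-filter⁻ (λ x → label x Fin.≟ k) {xs = xs} x∈k)))
                   (proj₂ (∈-filter⁻ (λ x → label x Fin.≟ l) {xs = xs} x∈l)))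

    length-concat-classes : ∀ ks → length (concat (map class ks)) ≡ sum (map (Vec.lookup sizes) ks)
    length-concat-classes [] = refl
    length-concat-classes (k ∷ ks) = trans (length-++ (class k))
      (cong₂ _+_ (sym (Vec.lookup∘tabulate (length ∘ class) k)) (length-concat-classes ks))

    -- This translates degrees and cardinalities of vertex sets into conditions on `sizes`, the only
    -- data that the finite checks see.
    total-sizes : ∀ p → total p sizes ≡ length (filterᵇ (p ∘ label) xs)
    total-sizes p = trans (sym (length-concat-classes ks)) (ℕ.≤-antisym
      (Unique-⊆⇒length≤ (concat-classes-! (Unique.filter⁺ (T? ∘ p) (allFin⁺ m))) to)
      (Unique-⊆⇒length≤ (Unique.filter⁺ (T? ∘ p ∘ label) xs!) from))
      where
      ks = filterᵇ p (allFin m)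
      to : concat (map class ks) ⊆ filterᵇ (p ∘ label) xs
      to x∈ with ys , x∈ys , ys∈ ← ∈-concat⁻′ (map class ks) x∈
            with k , k∈ , refl ← ∈-map⁻ class ys∈
            with x∈xs , refl ← ∈-filter⁻ (λ x → label x Fin.≟ k) {xs = xs} x∈ys
            = ∈-filter⁺ (T? ∘ p ∘ label) x∈xs (proj₂ (∈-filter⁻ (T? ∘ p) {xs = allFin m} k∈))
      from : filterᵇ (p ∘ label) xs ⊆ concat (map class ks)
      from {x} x∈ with x∈xs , px ← ∈-filter⁻ (T? ∘ p ∘ label) {xs = xs} x∈ =
        ∈-concat⁺′ (∈-filter⁺ (λ y → label y Fin.≟ label x) x∈xs refl)
          (∈-map⁺ class (∈-filter⁺ (T? ∘ p) (∈-allFin (label x)) px))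

    sum-sizes : Vec.sum sizes ≡ length xs
    sum-sizes = trans (sym (total-true sizes)) (trans (total-sizes (λ _ → true))
      (cong length (filter-all (λ _ → T? true) (All.universal (λ _ → tt) xs))))

    join-classes-! : Unique (join classes)
    join-classes-! = subst Unique (sym (join-tabulate class)) (concat-classes-! (allFin⁺ m))
      where
      join-tabulate′ : ∀ {n} (f : Fin n → List A) → join (Vec.tabulate f) ≡ concat (tabulate f)
      join-tabulate′ {zero} f = refl
      join-tabulate′ {suc n} f = cong (f zero ++_) (join-tabulate′ (f ∘ suc))
      join-tabulate : ∀ {n} (f : Fin n → List A) → join (Vec.tabulate f) ≡ concat (map f (allFin n))
      join-tabulate f = trans (join-tabulate′ f) (cong concat (sym (map-tabulate (λ i → i) f)))

    join-classes-⊆ : join classes ⊆ xs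
    join-classes-⊆ = go classes (λ k x∈ → proj₁ (∈-classes⁻ k x∈))
      where
      go : ∀ {n} (xss : Vec (List A) n) → (∀ k → Vec.lookup xss k ⊆ xs) → join xss ⊆ xs
      go (ys ∷ xss) s x∈ with ∈-++⁻ ys x∈
      ... | inj₁ x∈ys = s zero x∈ys
      ... | inj₂ x∈   = go xss (λ k → s (suc k)) x∈

-- Exhaustion over vectors with a given sum.

infixr 4 _⇒_

-- Branching on the premise spares the evaluation of the conclusion, usually a search, whenever the
-- premise fails.
_⇒_ : Bool → Bool → Bool
p ⇒ q = if p then q else true

⇒-elim : ∀ {p q} → T (p ⇒ q) → T p → T q
⇒-elim {true} t _ = t

forAll≤ : ℕ → (ℕ → Bool) → Bool
forAll≤ zero    f = f zero
forAll≤ (suc n) f = f (suc n) ∧ forAll≤ n f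

forAll≤-elim : ∀ n f → T (forAll≤ n f) → ∀ {k} → k ≤ n → T (f k)
forAll≤-elim zero    f t z≤n = t
forAll≤-elim (suc n) f t k≤ with ℕ.m≤n⇒m<n∨m≡n k≤
... | inj₁ (s≤s k≤n) = forAll≤-elim n f (proj₂ (Equivalence.to T-∧ t)) k≤n
... | inj₂ refl      = proj₁ (Equivalence.to T-∧ t)

forAllSum : ∀ m → ℕ → (Vec ℕ m → Bool) → Bool
forAllSum zero    zero    f = f []
-- The entries chosen so far fall short of the required sum, so there is nothing to check.
forAllSum zero    (suc _) f = true
forAllSum (suc m) n       f = forAll≤ n λ k → forAllSum m (n ∸ k) λ c → f (k ∷ c)

forAllSum-elim : ∀ {m} n f → T (forAllSum m n f) → (c : Vec ℕ m) → Vec.sum c ≡ n → T (f c)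
forAllSum-elim {zero}  zero f t [] eq = t
forAllSum-elim {suc m} n f t (k ∷ c) eq =
  forAllSum-elim (n ∸ k) (λ c → f (k ∷ c))
    (forAll≤-elim n (λ k → forAllSum m (n ∸ k) λ c → f (k ∷ c)) t
      (subst (k ≤_) eq (ℕ.m≤m+n k (Vec.sum c))))
    c (trans (sym (ℕ.m+n∸m≡n k (Vec.sum c))) (cong (_∸ k) eq))

guarded : ∀ {A : Set} → List (A → Bool) → (A → Bool) → A → Bool
guarded []       f c = f c
guarded (g ∷ gs) f c = g c ⇒ guarded gs f c

guarded-elim : ∀ {A : Set} (gs : List (A → Bool)) f {c} → T (guarded gs f c) → All (λ g → T (g c)) gs → T (f c)
guarded-elim []       f t []       = t
guarded-elim (g ∷ gs) f {c} t (p ∷ ps) = guarded-elim gs f (⇒-elim {g c} t p) ps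

forAllSum-guarded : ∀ {m} n gs f → T (forAllSum m n (guarded gs f)) →
                    ∀ c → Vec.sum c ≡ n → All (λ g → T (g c)) gs → T (f c)
forAllSum-guarded n gs f t c sum≡n = guarded-elim gs f (forAllSum-elim n (guarded gs f) t c sum≡n)

-- Three rows and seven columns.

-- A column of the bipartite graph between three rows and seven columns is
-- classified by the set of rows it is joined to, encoded in binary.
encode : Bool → Bool → Bool → Fin 8
encode false false false = # 0
encode false false true  = # 1
encode false true  false = # 2
encode false true  true  = # 3
encode true  false false = # 4
encode true  false true  = # 5
encode true  true  false = # 6
encode true  true  true  = # 7

-- Row 0 owns the leading digit, row 2 the last one.
bit : Fin 3 → Fin 8 → Bool
bit zero             (suc (suc (suc (suc _))))                         = true
bit (suc zero)       (suc (suc zero))                                  = true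
bit (suc zero)       (suc (suc (suc zero)))                            = true
bit (suc zero)       (suc (suc (suc (suc (suc (suc _))))))             = true
bit (suc (suc zero)) (suc zero)                                        = true
bit (suc (suc zero)) (suc (suc (suc zero)))                            = true
bit (suc (suc zero)) (suc (suc (suc (suc (suc zero)))))                = true
bit (suc (suc zero)) (suc (suc (suc (suc (suc (suc (suc _)))))))       = true
bit _ _ = false

bit-encode : ∀ (f : Fin 3 → Bool) r → bit r (encode (f (# 0)) (f (# 1)) (f (# 2))) ≡ f r
bit-encode f r with f (# 0) in e₀ | f (# 1) in e₁ | f (# 2) in e₂
bit-encode f zero | false | false | false = sym e₀
bit-encode f zero | false | false | true  = sym e₀
bit-encode f zero | false | true  | false = sym e₀
bit-encode f zero | false | true  | true  = sym e₀
bit-encode f zero | true  | false | false = sym e₀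
bit-encode f zero | true  | false | true  = sym e₀
bit-encode f zero | true  | true  | false = sym e₀
bit-encode f zero | true  | true  | true  = sym e₀
bit-encode f (suc zero) | false | false | false = sym e₁
bit-encode f (suc zero) | false | false | true  = sym e₁
bit-encode f (suc zero) | false | true  | false = sym e₁
bit-encode f (suc zero) | false | true  | true  = sym e₁
bit-encode f (suc zero) | true  | false | false = sym e₁
bit-encode f (suc zero) | true  | false | true  = sym e₁
bit-encode f (suc zero) | true  | true  | false = sym e₁
bit-encode f (suc zero) | true  | true  | true  = sym e₁
bit-encode f (suc (suc zero)) | false | false | false = sym e₂
bit-encode f (suc (suc zero)) | false | false | true  = sym e₂
bit-encode f (suc (suc zero)) | false | true  | false = sym e₂
bit-encode f (suc (suc zero)) | false | true  | true  = sym e₂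
bit-encode f (suc (suc zero)) | true  | false | false = sym e₂
bit-encode f (suc (suc zero)) | true  | false | true  = sym e₂
bit-encode f (suc (suc zero)) | true  | true  | false = sym e₂
bit-encode f (suc (suc zero)) | true  | true  | true  = sym e₂

-- Classes 0, 1 and 2 hold one row each; class 3 + k holds the columns of type k.
rowCompatible : Fin 11 → Fin 11 → Bool
rowCompatible zero             (suc (suc (suc k))) = bit (# 0) k
rowCompatible (suc zero)       (suc (suc (suc k))) = bit (# 1) k
rowCompatible (suc (suc zero)) (suc (suc (suc k))) = bit (# 2) k
rowCompatible (suc (suc (suc k))) zero             = bit (# 0) k
rowCompatible (suc (suc (suc k))) (suc zero)       = bit (# 1) k
rowCompatible (suc (suc (suc k))) (suc (suc zero)) = bit (# 2) k
rowCompatible _ _ = false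

abstract
  -- Each row may be visited once. Seven vertices starting with a column therefore alternate between
  -- four columns and all three rows.
  isEnd : Vec ℕ 8 → Fin 8 → Bool
  isEnd c k = Walks.walkFrom rowCompatible 6 (1 ∷ 1 ∷ 1 ∷ c) (suc (suc (suc k)))

  isEnd⇒walkFrom : ∀ c k → T (isEnd c k) →
                   T (Walks.walkFrom rowCompatible 6 (1 ∷ 1 ∷ 1 ∷ c) (suc (suc (suc k))))
  isEnd⇒walkFrom c k t = t

  -- Evaluated on the 3432 distributions of seven columns over eight types. Four ends suffice later
  -- because 4 + 4 > 7: some end is also a neighbour of a fourth row.
  fourEnds : ∀ c → Vec.sum c ≡ 7 → 4 ≤ total (bit (# 0)) c → 4 ≤ total (bit (# 1)) c →
             4 ≤ total (bit (# 2)) c → 4 ≤ total (isEnd c) c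
  fourEnds c sum≡7 4≤d₀ 4≤d₁ 4≤d₂ = ℕ.≤ᵇ⇒≤ 4 (total (isEnd c) c)
    (forAllSum-guarded 7 (degree (# 0) ∷ degree (# 1) ∷ degree (# 2) ∷ [])
      (λ c → 4 ≤ᵇ total (isEnd c) c) tt c sum≡7
      (ℕ.≤⇒≤ᵇ 4≤d₀ ∷ ℕ.≤⇒≤ᵇ 4≤d₁ ∷ ℕ.≤⇒≤ᵇ 4≤d₂ ∷ []))
    where
    degree : Fin 3 → Vec ℕ 8 → Bool
    degree r c = 4 ≤ᵇ total (bit r) c

does⇒ : ∀ {P : Set} (P? : Dec P) → T (does P?) → P
does⇒ (yes p) _ = p

⇒does : ∀ {P : Set} (P? : Dec P) → P → T (does P?)
⇒does (yes _) _ = tt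
⇒does (no ¬p) p = ¬p p

module ThreeRows
  {A : Set} (E : A → A → Set) (E? : ∀ x y → Dec (E x y)) (E-sym : ∀ {x y} → E x y → E y x)
  where

  degree : A → List A → ℕ
  degree x ys = length (filter (E? x) ys)

  module _ (a b c : A) (ys : List A) where

    row : Fin 3 → A
    row zero             = a
    row (suc zero)       = b
    row (suc (suc zero)) = c

    joined : A → Fin 3 → Bool
    joined y r = does (E? (row r) y)

    column : A → Fin 8
    column y = encode (joined y (# 0)) (joined y (# 1)) (joined y (# 2))

    bit-column : ∀ r y → bit r (column y) ≡ does (E? (row r) y)
    bit-column r y = bit-encode (joined y) r

    bit-sound : ∀ r {x y k} → T (bit r k) → x ≡ row r → column y ≡ k → E x y
    bit-sound r {y = y} t refl refl = does⇒ (E? (row r) y) (subst T (bit-column r y) t)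

    Class : Fin 11 → A → Set
    Class zero                y = y ≡ a
    Class (suc zero)          y = y ≡ b
    Class (suc (suc zero))    y = y ≡ c
    Class (suc (suc (suc k))) y = column y ≡ k

    rowCompatible-sound : ∀ {k l x y} → T (rowCompatible k l) → Class k x → Class l y → E x y
    rowCompatible-sound {zero}             {suc (suc (suc l))} t p q = bit-sound (# 0) t p q
    rowCompatible-sound {suc zero}         {suc (suc (suc l))} t p q = bit-sound (# 1) t p q
    rowCompatible-sound {suc (suc zero)}   {suc (suc (suc l))} t p q = bit-sound (# 2) t p q
    rowCompatible-sound {suc (suc (suc k))} {zero}             t p q = E-sym (bit-sound (# 0) t q p)
    rowCompatible-sound {suc (suc (suc k))} {suc zero}         t p q = E-sym (bit-sound (# 1) t q p)
    rowCompatible-sound {suc (suc (suc k))} {suc (suc zero)}   t p q = E-sym (bit-sound (# 2) t q p)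

    open WalkSoundness rowCompatible Class E rowCompatible-sound public using (Path)
    open WalkSoundness rowCompatible Class E rowCompatible-sound using (walkFrom-sound)
    open Classes column ys

    -- Six further vertices follow `y`, so `y` is an end of a P₇.
    End : A → Set
    End y = Path 6 y (a ∷ b ∷ c ∷ ys)

    fourColumnEnds : Unique (a ∷ b ∷ c ∷ ys) → length ys ≡ 7 →
                     4 ≤ degree a ys → 4 ≤ degree b ys → 4 ≤ degree c ys →
                     ∃ λ es → Unique es × 4 ≤ length es × es ⊆ ys × (∀ {e} → e ∈ es → End e)
    fourColumnEnds abcys! len dega degb degc =
      es , Unique.filter⁺ P? ys!
      , subst (4 ≤_) (total-sizes ys! (isEnd sizes)) manyEnds
      , (λ e∈ → proj₁ (∈-filter⁻ P? {xs = ys} e∈))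
      , end
      where
      ys! = Unique-++⁻ʳ (a ∷ b ∷ c ∷ []) abcys!
      P? = λ y → T? (isEnd sizes (column y))
      es = filterᵇ (λ y → isEnd sizes (column y)) ys
      row-total : ∀ r → 4 ≤ degree (row r) ys → 4 ≤ total (bit r) sizes
      row-total r deg = ℕ.≤-trans deg (subst (degree (row r) ys ≤_) (sym (total-sizes ys! (bit r)))
        (Unique-⊆⇒length≤ (Unique.filter⁺ (E? (row r)) ys!) λ {y} y∈ →
          let y∈ys , e = ∈-filter⁻ (E? (row r)) {xs = ys} y∈ in
          ∈-filter⁺ (λ y → T? (bit r (column y))) y∈ys
            (subst T (sym (bit-column r y)) (⇒does (E? (row r) y) e))))
      manyEnds : 4 ≤ total (isEnd sizes) sizes
      manyEnds = fourEnds sizes (trans (sum-sizes ys!) len) (row-total (# 0) dega) (row-total (# 1) degb) (row-total (# 2) degc)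
      xss : Vec (List A) 11
      xss = (a ∷ []) ∷ (b ∷ []) ∷ (c ∷ []) ∷ classes
      join-⊆ : join xss ⊆ a ∷ b ∷ c ∷ ys
      join-⊆ (here p) = here p
      join-⊆ (there (here p)) = there (here p)
      join-⊆ (there (there (here p))) = there (there (here p))
      join-⊆ (there (there (there x∈))) = there (there (there (join-classes-⊆ ys! x∈)))
      join-! : Unique (join xss)
      join-! = Unique.++⁺ (Unique-++⁻ˡ (a ∷ b ∷ c ∷ []) abcys!) (join-classes-! ys!)
        λ { (x∈abc , x∈) →
            Unique-++⇒Disjoint (a ∷ b ∷ c ∷ []) abcys! (x∈abc , join-classes-⊆ ys! x∈) }
      fits : ∀ k → Vec.lookup (1 ∷ 1 ∷ 1 ∷ sizes) k ≤ length (Vec.lookup xss k)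
      fits zero                = s≤s z≤n
      fits (suc zero)          = s≤s z≤n
      fits (suc (suc zero))    = s≤s z≤n
      fits (suc (suc (suc k))) = sizes-fit k
      classified : ∀ k {x} → x ∈ Vec.lookup xss k → Class k x
      classified zero                (here p) = p
      classified (suc zero)          (here p) = p
      classified (suc (suc zero))    (here p) = p
      classified (suc (suc (suc k))) x∈       = proj₂ (∈-classes⁻ k x∈)
      end : ∀ {e} → e ∈ es → End e
      end {e} e∈ with e∈ys , t ← ∈-filter⁻ P? {xs = ys} e∈
                with p , len , link , p! , p⊆ ←
                  walkFrom-sound 6 (1 ∷ 1 ∷ 1 ∷ sizes) (suc (suc (suc (column e))))
                    (isEnd⇒walkFrom sizes (column e) t) xss fits
                    classified join-!
                    (subst (e ∈_) (sym (Vec.lookup∘tabulate class (column e)))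
                      (∈-filter⁺ (λ x → column x Fin.≟ column e) e∈ys refl))
                = p , len , link , p! , λ x∈ → join-⊆ (p⊆ x∈)

-- Finite checks on pairs of kinds.

-- Kinds 0 and 1 stand for the sets Q and Z of a colour (see Covered), kind 2 for W.
differ : Fin 3 → Fin 3 → Bool
differ zero       zero       = false
differ (suc zero) (suc zero) = false
differ _          _          = true

acrossSides : Fin 2 → Fin 2 → Bool
acrossSides zero       (suc zero) = true
acrossSides (suc zero) zero       = true
acrossSides _          _          = false

_==_ : ∀ {n} → Fin n → Fin n → Bool
zero  == zero  = true
zero  == suc _ = false
suc _ == zero  = false
suc i == suc j = i == j

==⇒≡ : ∀ {n} {i j : Fin n} → T (i == j) → i ≡ j
==⇒≡ {i = zero}  {zero}  _ = refl
==⇒≡ {i = suc i} {suc j} t = cong suc (==⇒≡ t)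

≡⇒== : ∀ {n} {i j : Fin n} → i ≡ j → T (i == j)
≡⇒== {i = zero}  refl = tt
≡⇒== {i = suc i} refl = ≡⇒== {i = i} refl

-- A class is a pair: a kind or a side first, a kind in another colour second. Numbering the pairs
-- by one `Fin m` lets a single size vector be enumerated; the instances are tables, which evaluate
-- at once.
record Pairing (n m : ℕ) : Set where
  field
    pair     : Fin n → Fin 3 → Fin m
    fst      : Fin m → Fin n
    snd      : Fin m → Fin 3
    fst-pair : ∀ i j → fst (pair i j) ≡ i
    snd-pair : ∀ i j → snd (pair i j) ≡ j

  compatible : (Fin n → Fin n → Bool) → Fin m → Fin m → Bool
  compatible ok k l = ok (fst k) (fst l) ∧ differ (snd k) (snd l)

  ofKind : Fin n → Vec ℕ m → ℕ
  ofKind i = total (λ k → fst k == i)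

  ofKind′ : Fin 3 → Vec ℕ m → ℕ
  ofKind′ j = total (λ k → snd k == j)

pairing₃ : Pairing 3 9
pairing₃ = record
  { pair = pair ; fst = fst ; snd = snd ; fst-pair = fst-pair ; snd-pair = snd-pair }
  where
  pair : Fin 3 → Fin 3 → Fin 9
  pair zero zero = # 0
  pair zero (suc zero) = # 1
  pair zero (suc (suc zero)) = # 2
  pair (suc zero) zero = # 3
  pair (suc zero) (suc zero) = # 4
  pair (suc zero) (suc (suc zero)) = # 5
  pair (suc (suc zero)) zero = # 6
  pair (suc (suc zero)) (suc zero) = # 7
  pair (suc (suc zero)) (suc (suc zero)) = # 8
  fst : Fin 9 → Fin 3
  fst zero = # 0
  fst (suc zero) = # 0
  fst (suc (suc zero)) = # 0
  fst (suc (suc (suc zero))) = # 1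
  fst (suc (suc (suc (suc zero)))) = # 1
  fst (suc (suc (suc (suc (suc zero))))) = # 1
  fst (suc (suc (suc (suc (suc (suc zero)))))) = # 2
  fst (suc (suc (suc (suc (suc (suc (suc zero))))))) = # 2
  fst (suc (suc (suc (suc (suc (suc (suc (suc zero)))))))) = # 2
  snd : Fin 9 → Fin 3
  snd zero = # 0
  snd (suc zero) = # 1
  snd (suc (suc zero)) = # 2
  snd (suc (suc (suc zero))) = # 0
  snd (suc (suc (suc (suc zero)))) = # 1
  snd (suc (suc (suc (suc (suc zero))))) = # 2
  snd (suc (suc (suc (suc (suc (suc zero)))))) = # 0
  snd (suc (suc (suc (suc (suc (suc (suc zero))))))) = # 1
  snd (suc (suc (suc (suc (suc (suc (suc (suc zero)))))))) = # 2
  fst-pair : ∀ i j → fst (pair i j) ≡ i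
  fst-pair zero zero = refl
  fst-pair zero (suc zero) = refl
  fst-pair zero (suc (suc zero)) = refl
  fst-pair (suc zero) zero = refl
  fst-pair (suc zero) (suc zero) = refl
  fst-pair (suc zero) (suc (suc zero)) = refl
  fst-pair (suc (suc zero)) zero = refl
  fst-pair (suc (suc zero)) (suc zero) = refl
  fst-pair (suc (suc zero)) (suc (suc zero)) = refl
  snd-pair : ∀ i j → snd (pair i j) ≡ j
  snd-pair zero zero = refl
  snd-pair zero (suc zero) = refl
  snd-pair zero (suc (suc zero)) = refl
  snd-pair (suc zero) zero = refl
  snd-pair (suc zero) (suc zero) = refl
  snd-pair (suc zero) (suc (suc zero)) = refl
  snd-pair (suc (suc zero)) zero = refl
  snd-pair (suc (suc zero)) (suc zero) = refl
  snd-pair (suc (suc zero)) (suc (suc zero)) = refl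

pairing₂ : Pairing 2 6
pairing₂ = record
  { pair = pair ; fst = fst ; snd = snd ; fst-pair = fst-pair ; snd-pair = snd-pair }
  where
  pair : Fin 2 → Fin 3 → Fin 6
  pair zero zero = # 0
  pair zero (suc zero) = # 1
  pair zero (suc (suc zero)) = # 2
  pair (suc zero) zero = # 3
  pair (suc zero) (suc zero) = # 4
  pair (suc zero) (suc (suc zero)) = # 5
  fst : Fin 6 → Fin 2
  fst zero = # 0
  fst (suc zero) = # 0
  fst (suc (suc zero)) = # 0
  fst (suc (suc (suc zero))) = # 1
  fst (suc (suc (suc (suc zero)))) = # 1
  fst (suc (suc (suc (suc (suc zero))))) = # 1
  snd : Fin 6 → Fin 3
  snd zero = # 0
  snd (suc zero) = # 1
  snd (suc (suc zero)) = # 2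
  snd (suc (suc (suc zero))) = # 0
  snd (suc (suc (suc (suc zero)))) = # 1
  snd (suc (suc (suc (suc (suc zero))))) = # 2
  fst-pair : ∀ i j → fst (pair i j) ≡ i
  fst-pair zero zero = refl
  fst-pair zero (suc zero) = refl
  fst-pair zero (suc (suc zero)) = refl
  fst-pair (suc zero) zero = refl
  fst-pair (suc zero) (suc zero) = refl
  fst-pair (suc zero) (suc (suc zero)) = refl
  snd-pair : ∀ i j → snd (pair i j) ≡ j
  snd-pair zero zero = refl
  snd-pair zero (suc zero) = refl
  snd-pair zero (suc (suc zero)) = refl
  snd-pair (suc zero) zero = refl
  snd-pair (suc zero) (suc zero) = refl
  snd-pair (suc zero) (suc (suc zero)) = refl

module EightVertices where

  open Pairing pairing₃

  abstract
    -- Outside the sets `S` of two covered colours, an edge is sure to have the third colour unless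
    -- both ends share `Q` or share `Z` in one of the two. The bounds 3 are the size of `Q` and the
    -- bound proved below on the part of `Z` outside the other colour's `S`. There are 12870 size
    -- vectors with sum 8.
    hamiltonian : ∀ c → Vec.sum c ≡ 8 → ofKind (# 0) c ≤ 3 → ofKind (# 1) c ≤ 3 →
                  ofKind′ (# 0) c ≤ 3 → ofKind′ (# 1) c ≤ 3 →
                  T (Walks.walkSomewhere (compatible differ) 7 c)
    -- Exposing the nine entries makes the four totals reduce to the sums written out in `kinds`.
    hamiltonian c@(_ ∷ _ ∷ _ ∷ _ ∷ _ ∷ _ ∷ _ ∷ _ ∷ _ ∷ []) sum≡8 p q s t =
      forAllSum-guarded 8 (kinds ∷ []) (Walks.walkSomewhere (compatible differ) 7) tt c sum≡8
        (Equivalence.from T-∧ (ℕ.≤⇒≤ᵇ p , Equivalence.from T-∧ (ℕ.≤⇒≤ᵇ q ,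
          Equivalence.from T-∧ (ℕ.≤⇒≤ᵇ s , ℕ.≤⇒≤ᵇ t))) ∷ [])
      where
      -- ofKind and ofKind′ unfolded, for speed.
      kinds : Vec ℕ 9 → Bool
      kinds (c₀₀ ∷ c₀₁ ∷ c₀₂ ∷ c₁₀ ∷ c₁₁ ∷ c₁₂ ∷ c₂₀ ∷ c₂₁ ∷ c₂₂ ∷ []) =
        (c₀₀ + (c₀₁ + (c₀₂ + 0)) ≤ᵇ 3) ∧ (c₁₀ + (c₁₁ + (c₁₂ + 0)) ≤ᵇ 3) ∧
        (c₀₀ + (c₁₀ + (c₂₀ + 0)) ≤ᵇ 3) ∧ (c₀₁ + (c₁₁ + (c₂₁ + 0)) ≤ᵇ 3)

module FourBySix where

  open Pairing pairing₂

  abstract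
    -- A path on eight vertices that alternates between sides of sizes 4 and 6 exhausts the smaller
    -- side. The bounds 3 and 5 are those on `Q` and `Z` of a covered colour.
    has-P₈ : ∀ c → Vec.sum c ≡ 10 → 4 ≤ ofKind (# 0) c → ofKind (# 0) c ≤ 4 →
             ofKind′ (# 0) c ≤ 3 → ofKind′ (# 1) c ≤ 5 →
             T (Walks.walkSomewhere (compatible acrossSides) 7 c)
    has-P₈ c sum≡10 p q s t =
      forAllSum-guarded 10
        ((λ c → 4 ≤ᵇ ofKind (# 0) c) ∷ (λ c → ofKind (# 0) c ≤ᵇ 4)
          ∷ (λ c → ofKind′ (# 0) c ≤ᵇ 3) ∷ (λ c → ofKind′ (# 1) c ≤ᵇ 5) ∷ [])
        (Walks.walkSomewhere (compatible acrossSides) 7) tt c sum≡10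
        (ℕ.≤⇒≤ᵇ p ∷ ℕ.≤⇒≤ᵇ q ∷ ℕ.≤⇒≤ᵇ s ∷ ℕ.≤⇒≤ᵇ t ∷ [])

-- Bipartite patterns excluded by the absence of a monochromatic P₈.

V : Set
V = Fin 14

unique? : ∀ {n} (is : List (Fin n)) → Dec (Unique is)
unique? = DecUnique.unique? Fin._≟_

open DecMembership (Fin._≟_ {14}) using (_∈?_)

-- Colourings are handled as symmetric functions; values on the diagonal never matter.
module NoMonochromaticP₈
  (col : V → V → Fin 3) (col-sym : ∀ u v → col u v ≡ col v u)
  (noP₈ : ∀ i p → Unique p → Linked (λ u v → col u v ≡ i) p → length p ≢ 8)
  where

  E : Fin 3 → V → V → Set
  E i u v = col u v ≡ i

  E? : ∀ i u v → Dec (E i u v)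
  E? i u v = col u v Fin.≟ i

  E-sym : ∀ {i u v} → E i u v → E i v u
  E-sym {u = u} {v} e = trans (col-sym v u) e

  -- Paths and cycles below are written as index lists into a list without repetitions, so that the
  -- distinctness of their vertices is decided by evaluation.
  Unique-select : ∀ {base : List V} → Unique base → (is : List (Fin (length base))) →
                  {True (unique? is)} → Unique (map (lookup base) is)
  Unique-select base! is {is!} = Unique.map⁺ (lookup-injective base!) (toWitness is!)

  noP₈-select : ∀ i {base : List V} → Unique base → (is : List (Fin (length base))) →
                {True (unique? is)} → length is ≡ 8 → Linked (E i) (map (lookup base) is) → ⊥
  noP₈-select i {base} base! is {is!} len link =
    noP₈ i (map (lookup base) is) (Unique-select base! is {is!}) link
      (trans (length-map (lookup base) is) len)

  -- One of the at least four ends of the P₇s through a, b, c is joined to d.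
  fourRows : ∀ i {a b c d ys} → Unique (d ∷ a ∷ b ∷ c ∷ ys) → length ys ≡ 7 →
             (∀ {x} → x ∈ a ∷ b ∷ c ∷ d ∷ [] → 4 ≤ length (filter (E? i x) ys)) → ⊥
  fourRows i {a} {b} {c} {d} {ys} u len deg = contradictory
    (fourColumnEnds a b c ys (Unique-tail u) len
      (deg (here refl)) (deg (there (here refl))) (deg (there (there (here refl)))))
    where
    open ThreeRows (E i) (E? i) (E-sym {i})
    contradictory : (∃ λ es → Unique es × 4 ≤ length es × es ⊆ ys × (∀ {e} → e ∈ es → End a b c ys e)) → ⊥
    contradictory (es , es! , 4≤es , es⊆ys , end) =
      ℕ.<⇒≱ (s≤s (subst (length (es ++ ds) ≤_) len
        (Unique-⊆⇒length≤ (Unique.++⁺ es! (Unique.filter⁺ (E? i d) (Unique-++⁻ʳ (d ∷ a ∷ b ∷ c ∷ []) u)) disjoint) ⊆ys)))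
        (subst (8 ≤_) (sym (length-++ es)) (ℕ.+-mono-≤ 4≤es (deg (there (there (there (here refl)))))))
      where
      ds : List V
      ds = filter (E? i d) ys
      disjoint : ∀ {y} → y ∈ es × y ∈ ds → ⊥
      disjoint (y∈es , y∈ds) with p , len′ , link , p! , p⊆ ← end y∈es =
        noP₈ i (d ∷ _ ∷ p) (∷-Unique (λ d∈ → Unique[x∷xs]⇒x∉xs u (p⊆ d∈)) p!)
          (proj₂ (∈-filter⁻ (E? i d) {xs = ys} y∈ds) ∷ link) (cong (λ n → suc (suc n)) len′)
      ⊆ys : es ++ ds ⊆ ys
      ⊆ys y∈ with ∈-++⁻ es y∈
      ... | inj₁ y∈es = es⊆ys y∈es
      ... | inj₂ y∈ds = proj₁ (∈-filter⁻ (E? i d) {xs = ys} y∈ds)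

  -- x c d₁ c′ d₂ c″ d₃ c‴ would be a monochromatic P₈.
  noEdgeTo-K₃₄ : ∀ i {x d₁ d₂ d₃ cs} → Unique (x ∷ d₁ ∷ d₂ ∷ d₃ ∷ cs) → 4 ≤ length cs →
                 (∀ {d c} → d ∈ d₁ ∷ d₂ ∷ d₃ ∷ [] → c ∈ cs → E i d c) →
                 ∀ {c} → c ∈ cs → ¬ E i x c
  noEdgeTo-K₃₄ i {x} {d₁} {d₂} {d₃} {cs} u 4≤ full {c} c∈ xc with ∈⇒↭ c∈
  ... | ys , p = alternating ys p (ℕ.≤-pred (subst (4 ≤_) (↭-length p) 4≤))
    where
    alternating : ∀ ys → cs ↭ c ∷ ys → 3 ≤ length ys → ⊥
    alternating (_ ∷ []) p (s≤s ())
    alternating (_ ∷ _ ∷ []) p (s≤s (s≤s ()))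
    alternating (c₁ ∷ c₂ ∷ c₃ ∷ zs) p _ =
      noP₈-select i (Unique-resp-↭ (++⁺ˡ (x ∷ d₁ ∷ d₂ ∷ d₃ ∷ []) p) u)
        (# 0 ∷ # 4 ∷ # 1 ∷ # 5 ∷ # 2 ∷ # 6 ∷ # 3 ∷ # 7 ∷ []) refl
        (xc ∷ cd (# 0) (# 0) ∷ dc (# 0) (# 1) ∷ cd (# 1) (# 1) ∷ dc (# 1) (# 2) ∷ cd (# 2) (# 2) ∷ dc (# 2) (# 3) ∷ [-])
      where
      dc : ∀ k l → E i (lookup (d₁ ∷ d₂ ∷ d₃ ∷ []) k) (lookup (c ∷ c₁ ∷ c₂ ∷ c₃ ∷ zs) l)
      dc k l = full (∈-lookup k) (∈-resp-↭ (↭-sym p) (∈-lookup l))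
      cd : ∀ l k → E i (lookup (c ∷ c₁ ∷ c₂ ∷ c₃ ∷ zs) l) (lookup (d₁ ∷ d₂ ∷ d₃ ∷ []) k)
      cd l k = E-sym (dc k l)

  noK₄₄ : ∀ i xs {ys} → length xs ≡ 4 → 4 ≤ length ys → Unique (xs ++ ys) →
          ¬ (∀ {x y} → x ∈ xs → y ∈ ys → E i x y)
  noK₄₄ i (x ∷ d₁ ∷ d₂ ∷ d₃ ∷ []) {ys@(_ ∷ _)} refl 4≤ u full =
    noEdgeTo-K₃₄ i u 4≤ (λ d∈ → full (there d∈)) (here refl) (full (here refl) (here refl))

  -- `r`, `b`, `g` may be any listing of the three colours, so that each colour can be put in the
  -- role of red.
  module TwoColours {r b g : Fin 3} (colours : ∀ i → i ≡ r ⊎ i ≡ b ⊎ i ≡ g) where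

    NoRed : List V → List V → Set
    NoRed xs ys = ∀ {x y} → x ∈ xs → y ∈ ys → ¬ E r x y

    majority : ∀ {x} ys → length ys ≡ 7 → (∀ {y} → y ∈ ys → ¬ E r x y) →
               ¬ 4 ≤ length (filter (E? b x) ys) → 4 ≤ length (filter (E? g x) ys)
    majority {x} ys len nored few = ℕ.+-cancelˡ-≤ 3 4 _ (ℕ.≤-trans (subst (_≤ cb + cg) len (cover ys nored))
      (ℕ.+-monoˡ-≤ cg (ℕ.≤-pred (ℕ.≰⇒> few))))
      where
      cb = length (filter (E? b x) ys)
      cg = length (filter (E? g x) ys)
      cover : ∀ ys → (∀ {y} → y ∈ ys → ¬ E r x y) →
              length ys ≤ length (filter (E? b x) ys) + length (filter (E? g x) ys)
      cover [] _ = z≤n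
      cover (y ∷ ys) nr with cover ys (λ y∈ → nr (there y∈)) | E? b x y | E? g x y
      ... | ih | yes _ | yes _ = s≤s (ℕ.≤-trans ih (ℕ.+-monoʳ-≤ _ (ℕ.n≤1+n _)))
      ... | ih | yes _ | no _  = s≤s ih
      ... | ih | no _  | yes _ = subst (suc (length ys) ≤_) (sym (ℕ.+-suc _ _)) (s≤s ih)
      ... | ih | no ¬b | no ¬g with colours (col x y)
      ...   | inj₁ e        = ⊥-elim (nr (here refl) e)
      ...   | inj₂ (inj₁ e) = ⊥-elim (¬b e)
      ...   | inj₂ (inj₂ e) = ⊥-elim (¬g e)

    Rows : List V → List V → Fin 3 → List V → Set
    Rows xs ys i zs = length zs ≡ 3 × Unique zs ×
      (∀ {x} → x ∈ zs → x ∈ xs × 4 ≤ length (filter (E? i x) ys))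

    module _ {xs ys : List V} (u : Unique (xs ++ ys)) (len : length ys ≡ 7) (nored : NoRed xs ys) where

      private
        many? : ∀ x → Dec (4 ≤ length (filter (E? b x) ys))
        many? x = 4 ℕ.≤? length (filter (E? b x) ys)

        blue green : List V
        blue  = filter many? xs
        green = filter (¬? ∘ many?) xs

        blue-rows : ∀ {x} → x ∈ blue → x ∈ xs × 4 ≤ length (filter (E? b x) ys)
        blue-rows = ∈-filter⁻ many? {xs = xs}

        green-rows : ∀ {x} → x ∈ green → x ∈ xs × 4 ≤ length (filter (E? g x) ys)
        green-rows x∈ = let x∈xs , few = ∈-filter⁻ (¬? ∘ many?) {xs = xs} x∈ in
          x∈xs , majority ys len (nored x∈xs) few

        sub! : ∀ {zs} → Unique zs → zs ⊆ xs → Unique (zs ++ ys)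
        sub! zs! zs⊆xs = Unique.++⁺ zs! (Unique-++⁻ʳ xs u)
          λ { (x∈zs , x∈ys) → Unique-++⇒Disjoint xs u (zs⊆xs x∈zs , x∈ys) }

        -- A fourth such row would contradict `fourRows`. As every row has a majority colour, blue
        -- or green, there are at most 3 + 3 rows in all.
        atMostThree : ∀ i {zs} → Unique zs → (∀ {x} → x ∈ zs → x ∈ xs × 4 ≤ length (filter (E? i x) ys)) →
                      length zs ≤ 3
        atMostThree i {[]} _ _ = z≤n
        atMostThree i {_ ∷ []} _ _ = s≤s z≤n
        atMostThree i {_ ∷ _ ∷ []} _ _ = s≤s (s≤s z≤n)
        atMostThree i {_ ∷ _ ∷ _ ∷ []} _ _ = s≤s (s≤s (s≤s z≤n))
        atMostThree i {d ∷ a ∷ b′ ∷ c ∷ zs} zs! rows =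
          ⊥-elim (fourRows i (sub! (Unique-++⁻ˡ (d ∷ a ∷ b′ ∷ c ∷ []) zs!) λ x∈ → proj₁ (rows (∈-++⁺ˡ x∈))) len λ where
            (here refl)                         → proj₂ (rows (there (here refl)))
            (there (here refl))                 → proj₂ (rows (there (there (here refl))))
            (there (there (here refl)))         → proj₂ (rows (there (there (there (here refl)))))
            (there (there (there (here refl)))) → proj₂ (rows (here refl)))

        blue! : Unique blue
        blue! = Unique.filter⁺ many? (Unique-++⁻ˡ xs u)

        green! : Unique green
        green! = Unique.filter⁺ (¬? ∘ many?) (Unique-++⁻ˡ xs u)

        lengths : length xs ≡ length blue + length green
        lengths = length-filter-¬ many? xs

        blue≤3 : length blue ≤ 3
        blue≤3 = atMostThree b blue! blue-rows

        green≤3 : length green ≤ 3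
        green≤3 = atMostThree g green! green-rows

      atMostSixRows : length xs ≤ 6
      atMostSixRows = subst (_≤ 6) (sym lengths) (ℕ.+-mono-≤ blue≤3 green≤3)

      threeAndThree : length xs ≡ 6 →
                      ∃ λ bs → ∃ λ gs → Rows xs ys b bs × Rows xs ys g gs × Disjoint bs gs
      threeAndThree len₆ = blue , green
        , (ℕ.≤-antisym blue≤3 (ℕ.+-cancelʳ-≤ 3 3 (length blue) (ℕ.≤-trans six (ℕ.+-monoʳ-≤ (length blue) green≤3)))
          , blue! , blue-rows)
        , (ℕ.≤-antisym green≤3 (ℕ.+-cancelˡ-≤ 3 3 (length green) (ℕ.≤-trans six (ℕ.+-monoˡ-≤ (length green) blue≤3)))
          , green! , green-rows)
        , λ { (x∈b , x∈g) → proj₂ (∈-filter⁻ (¬? ∘ many?) {xs = xs} x∈g) (proj₂ (∈-filter⁻ many? {xs = xs} x∈b)) }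
        where
        six : 6 ≤ length blue + length green
        six = ℕ.≤-reflexive (trans (sym len₆) lengths)

    noBipartite₇₇ : ∀ {xs ys} → Unique (xs ++ ys) → length xs ≡ 7 → length ys ≡ 7 → ¬ NoRed xs ys
    noBipartite₇₇ u lx ly nored =
      ℕ.<⇒≱ (ℕ.n<1+n 6) (subst (_≤ 6) lx (atMostSixRows u ly nored))

    notRed : ∀ {u v} → ¬ E r u v → E b u v ⊎ E g u v
    notRed {u} {v} ¬r with colours (col u v)
    ... | inj₁ e = ⊥-elim (¬r e)
    ... | inj₂ e = e

    -- Four columns are completely blue to three rows and completely green to the
    -- other three, so all edges to the remaining four columns are red.
    noBipartite₆₈ : ∀ {xs ys} → Unique (xs ++ ys) → length xs ≡ 6 → length ys ≡ 8 → ¬ NoRed xs ys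
    noBipartite₆₈ {xs} {y₀ ∷ ys} u lx ly nored =
      -- The count of rows is about seven columns, so `y₀` is set aside; it returns as one of the
      -- four columns in `os`.
      split (threeAndThree xsys! lys (λ x∈ y∈ → nored x∈ (there y∈)) lx)
      where
      xsys! : Unique (xs ++ ys)
      xsys! = Unique-tail (Unique-resp-↭ (shift y₀ xs ys) u)
      lys : length ys ≡ 7
      lys = ℕ.suc-injective ly
      ++! : ∀ {zs ws} → Unique zs → zs ⊆ xs → Unique ws → ws ⊆ y₀ ∷ ys → Unique (zs ++ ws)
      ++! zs! zs⊆ ws! ws⊆ = Unique.++⁺ zs! ws! λ { (z∈ , w∈) → Unique-++⇒Disjoint xs u (zs⊆ z∈ , ws⊆ w∈) }

      columns : ∀ {a₁ a₂ a₃ d₁ d₂ d₃} → let as = a₁ ∷ a₂ ∷ a₃ ∷ []; ds = d₁ ∷ d₂ ∷ d₃ ∷ [] in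
                Unique as → as ⊆ xs → Unique ds → ds ⊆ xs → Disjoint as ds →
                (∃ λ es → Unique es × 4 ≤ length es × es ⊆ ys ×
                  (∀ {e} → e ∈ es → ThreeRows.End (E b) (E? b) (E-sym {b}) a₁ a₂ a₃ ys e)) → ⊥
      columns {a₁} {a₂} {a₃} {d₁} {d₂} {d₃} as! as⊆ ds! ds⊆ disjoint (es , es! , 4≤ , es⊆ , end) =
        rest (Unique-⊆⇒↭ es₄! (λ e∈ → there (es₄⊆ e∈)))
        where
        as ds es₄ : List V
        as = a₁ ∷ a₂ ∷ a₃ ∷ []
        ds = d₁ ∷ d₂ ∷ d₃ ∷ []
        es₄ = take 4 es
        es₄! : Unique es₄
        es₄! = Unique.take⁺ 4 es!
        es₄⊆ : es₄ ⊆ ys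
        es₄⊆ e∈ = es⊆ (take-⊆ 4 es e∈)
        es₄⊆′ : es₄ ⊆ y₀ ∷ ys
        es₄⊆′ e∈ = there (es₄⊆ e∈)
        len₄ : length es₄ ≡ 4
        len₄ = length-take-≤ {n = 4} {es} 4≤
        four : 4 ≤ length es₄
        four = ℕ.≤-reflexive (sym len₄)
        -- A blue edge `d e` would prolong the blue P₇ that ends in `e`, whose only rows are those
        -- of `as`.
        green : ∀ {d e} → d ∈ ds → e ∈ es₄ → E g d e
        green {d} {e} d∈ e∈ with notRed (nored (ds⊆ d∈) (es₄⊆′ e∈))
        ... | inj₂ de = de
        ... | inj₁ de with p , len , link , p! , p⊆ ← end (take-⊆ 4 es e∈) =
          ⊥-elim (noP₈ b (d ∷ e ∷ p) (∷-Unique (λ d∈p → d∉ (p⊆ d∈p)) p!) (de ∷ link) (cong (λ n → suc (suc n)) len))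
          where
          d∉ : d ∉ a₁ ∷ a₂ ∷ a₃ ∷ ys
          d∉ d∈′ with ∈-++⁻ as d∈′
          ... | inj₁ d∈as = disjoint (d∈as , d∈)
          ... | inj₂ d∈ys = Unique-++⇒Disjoint xs xsys! (ds⊆ d∈ , d∈ys)
        -- The rows `ds` and the columns `es₄` now form a green K₃₄, and no further green edge may
        -- end in one of its four columns.
        blue : ∀ {a e} → a ∈ as → e ∈ es₄ → E b a e
        blue {a} a∈ e∈ with notRed (nored (as⊆ a∈) (es₄⊆′ e∈))
        ... | inj₁ ae = ae
        ... | inj₂ ae = ⊥-elim (noEdgeTo-K₃₄ g (∷-Unique a∉ (++! ds! ds⊆ es₄! es₄⊆′)) four green e∈ ae)
          where
          a∉ : a ∉ ds ++ es₄
          a∉ a∈′ with ∈-++⁻ ds a∈′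
          ... | inj₁ a∈ds = disjoint (a∈ , a∈ds)
          ... | inj₂ a∈es = Unique-++⇒Disjoint xs u (as⊆ a∈ , es₄⊆′ a∈es)
        rest : (∃ λ os → y₀ ∷ ys ↭ es₄ ++ os) → ⊥
        rest (os , p) = noK₄₄ r es₄ len₄ fourLeft es₄os! λ e∈ o∈ → E-sym (red o∈ e∈)
          where
          es₄os! : Unique (es₄ ++ os)
          es₄os! = Unique-resp-↭ p (Unique-++⁻ʳ xs u)
          fourLeft : 4 ≤ length os
          fourLeft = ℕ.≤-reflexive (sym (ℕ.+-cancelˡ-≡ 4 (length os) 4
            (trans (cong (_+ length os) (sym len₄)) (trans (sym (length-++ es₄)) (trans (sym (↭-length p)) ly)))))
          os⊆ : os ⊆ y₀ ∷ ys
          os⊆ o∈ = ∈-resp-↭ (↭-sym p) (∈-++⁺ʳ es₄ o∈)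
          o∉ : ∀ {o zs} → o ∈ os → zs ⊆ xs → o ∉ zs ++ es₄
          o∉ {zs = zs} o∈ zs⊆ o∈′ with ∈-++⁻ zs o∈′
          ... | inj₁ o∈zs = Unique-++⇒Disjoint xs u (zs⊆ o∈zs , os⊆ o∈)
          ... | inj₂ o∈es = Unique-++⇒Disjoint es₄ es₄os! (o∈es , o∈)
          red : ∀ {o e} → o ∈ os → e ∈ es₄ → E r o e
          red {o} {e} o∈ e∈ with colours (col o e)
          ... | inj₁ oe = oe
          ... | inj₂ (inj₁ oe) = ⊥-elim (noEdgeTo-K₃₄ b (∷-Unique (o∉ o∈ as⊆) (++! as! as⊆ es₄! es₄⊆′)) four blue e∈ oe)
          ... | inj₂ (inj₂ oe) = ⊥-elim (noEdgeTo-K₃₄ g (∷-Unique (o∉ o∈ ds⊆) (++! ds! ds⊆ es₄! es₄⊆′)) four green e∈ oe)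

      split : (∃ λ bs → ∃ λ gs → Rows xs ys b bs
                × Rows xs ys g gs × Disjoint bs gs) → ⊥
      split (a₁ ∷ a₂ ∷ a₃ ∷ [] , d₁ ∷ d₂ ∷ d₃ ∷ [] , (refl , as! , rows-a) , (refl , ds! , rows-d) , disjoint) =
        columns as! (λ x∈ → proj₁ (rows-a x∈)) ds! (λ x∈ → proj₁ (rows-d x∈)) disjoint
          (ThreeRows.fourColumnEnds (E b) (E? b) (E-sym {b}) a₁ a₂ a₃ ys
            (Unique.++⁺ as! (Unique-++⁻ʳ xs xsys!)
              (λ { (x∈as , x∈ys) → Unique-++⇒Disjoint xs xsys! (proj₁ (rows-a x∈as) , x∈ys) }))
            lys (proj₂ (rows-a (here refl))) (proj₂ (rows-a (there (here refl))))
            (proj₂ (rows-a (there (there (here refl))))))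

  -- Counting the edges of one colour.

  degree : Fin 3 → V → List V → ℕ
  degree i v L = length (filter (E? i v) L)

  -- Each vertex counts its neighbours later in the list, so an edge is counted once; by `edges-↭`
  -- the order does not matter.
  edges : Fin 3 → List V → ℕ
  edges i []      = 0
  edges i (v ∷ L) = degree i v L + edges i L

  pairs : ℕ → ℕ
  pairs zero    = 0
  pairs (suc n) = n + pairs n

  degree-↭ : ∀ i v {L M} → L ↭ M → degree i v L ≡ degree i v M
  degree-↭ i v p = ↭-length (filter-↭ (E? i v) p)

  joined : Fin 3 → V → V → ℕ
  joined i u v = if does (E? i u v) then 1 else 0

  joined-sym : ∀ i u v → joined i u v ≡ joined i v u
  joined-sym i u v rewrite col-sym u v = refl

  degree-∷ : ∀ i u v L → degree i u (v ∷ L) ≡ joined i u v + degree i u L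
  degree-∷ i u v L with E? i u v
  ... | yes _ = refl
  ... | no _  = refl

  edges-↭ : ∀ i {L M} → L ↭ M → edges i L ≡ edges i M
  edges-↭ i _↭_.refl = refl
  edges-↭ i (prep v p) = cong₂ _+_ (degree-↭ i v p) (edges-↭ i p)
  edges-↭ i {L = u ∷ v ∷ L} {_ ∷ _ ∷ M} (swap u v p)
    rewrite degree-∷ i u v L | degree-∷ i v u M | joined-sym i v u
          | sym (degree-↭ i u p) | sym (degree-↭ i v p) | sym (edges-↭ i p)
    = exchange (joined i u v) (degree i u L) (degree i v L) (edges i L)
    where
    exchange : ∀ j k l m → (j + k) + (l + m) ≡ (j + l) + (k + m)
    exchange = solve-∀
  edges-↭ i (_↭_.trans p q) = trans (edges-↭ i p) (edges-↭ i q)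

  edges-∷ : ∀ i {v L M} → Unique L → (∀ {w} → w ∈ L → E i v w → w ∈ M) →
            edges i (v ∷ L) ≤ length M + edges i L
  edges-∷ i {v} {L} L! nbrs = ℕ.+-monoˡ-≤ (edges i L)
    (Unique-⊆⇒length≤ (Unique.filter⁺ (E? i v) L!) λ w∈ →
      let w∈L , vw = ∈-filter⁻ (E? i v) {xs = L} w∈ in nbrs w∈L vw)

  -- Bounds the number of edges meeting n vertices all of whose neighbours are
  -- among these n vertices and m others.
  closedBound : ℕ → ℕ → ℕ
  closedBound zero    m = 0
  closedBound (suc n) m = (n + m) + closedBound n m

  -- Taking the vertices of `ps` away one by one, each has its remaining neighbours among the rest
  -- of `ps` and `M`.
  edges-closed : ∀ i ps M {L} → Unique (ps ++ L) →
                 (∀ {p w} → p ∈ ps → w ∈ ps ++ L → E i p w → w ∈ ps ++ M) →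
                 edges i (ps ++ L) ≤ closedBound (length ps) (length M) + edges i L
  edges-closed i []       M u nbrs = ℕ.≤-refl
  edges-closed i (p ∷ ps) M {L} u@(_ ∷ u′) nbrs = begin
    edges i (p ∷ ps ++ L)
      ≤⟨ edges-∷ i u′ (λ w∈ pw → strip w∈ (nbrs (here refl) (there w∈) pw)) ⟩
    length (ps ++ M) + edges i (ps ++ L)
      ≡⟨ cong (_+ edges i (ps ++ L)) (length-++ ps) ⟩
    (length ps + length M) + edges i (ps ++ L)
      ≤⟨ ℕ.+-monoʳ-≤ (length ps + length M)
           (edges-closed i ps M u′ λ q∈ w∈ qw → strip w∈ (nbrs (there q∈) (there w∈) qw)) ⟩
    (length ps + length M) + (closedBound (length ps) (length M) + edges i L)
      ≡⟨ sym (ℕ.+-assoc (length ps + length M) _ _) ⟩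
    closedBound (length (p ∷ ps)) (length M) + edges i L ∎
    where
    open ℕ.≤-Reasoning
    strip : ∀ {w} → w ∈ ps ++ L → w ∈ p ∷ ps ++ M → w ∈ ps ++ M
    strip w∈ (here refl) = ⊥-elim (Unique[x∷xs]⇒x∉xs u w∈)
    strip w∈ (there w∈′) = w∈′

  edges-independent : ∀ i ws M {L} → Unique (ws ++ L) →
                      (∀ {w v} → w ∈ ws → v ∈ ws ++ L → w ≢ v → E i w v → v ∈ M) →
                      edges i (ws ++ L) ≤ length ws * length M + edges i L
  edges-independent i []       M u nbrs = ℕ.≤-refl
  edges-independent i (w ∷ ws) M {L} u@(_ ∷ u′) nbrs = begin
    edges i (w ∷ ws ++ L)
      ≤⟨ edges-∷ i u′ (λ v∈ → nbrs (here refl) (there v∈) λ { refl → Unique[x∷xs]⇒x∉xs u v∈ }) ⟩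
    length M + edges i (ws ++ L)
      ≤⟨ ℕ.+-monoʳ-≤ (length M) (edges-independent i ws M u′ λ w∈ v∈ → nbrs (there w∈) (there v∈)) ⟩
    length M + (length ws * length M + edges i L)
      ≡⟨ sym (ℕ.+-assoc (length M) _ _) ⟩
    length (w ∷ ws) * length M + edges i L ∎
    where open ℕ.≤-Reasoning

  edges-total : ∀ {r b g} → (∀ i → i ≡ r ⊎ i ≡ b ⊎ i ≡ g) → ∀ L →
                pairs (length L) ≤ edges r L + (edges b L + edges g L)
  edges-total colours [] = z≤n
  edges-total {r} {b} {g} colours (v ∷ L) = begin
    length L + pairs (length L)
      ≤⟨ ℕ.+-mono-≤ (degrees L) (edges-total colours L) ⟩
    (degree r v L + (degree b v L + degree g v L)) + (edges r L + (edges b L + edges g L))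
      ≡⟨ interchange (degree r v L) (degree b v L) (degree g v L) (edges r L) (edges b L) (edges g L) ⟩
    edges r (v ∷ L) + (edges b (v ∷ L) + edges g (v ∷ L)) ∎
    where
    open ℕ.≤-Reasoning
    interchange : ∀ a b c a′ b′ c′ → (a + (b + c)) + (a′ + (b′ + c′)) ≡ (a + a′) + ((b + b′) + (c + c′))
    interchange = solve-∀
    accept : ∀ {i w} M → E i v w → suc (degree i v M) ≤ degree i v (w ∷ M)
    accept {i} M vw = ℕ.≤-reflexive (cong length (sym (filter-accept (E? i v) {xs = M} vw)))
    grow : ∀ i w M → degree i v M ≤ degree i v (w ∷ M)
    grow i w M with E? i v w
    ... | yes _ = ℕ.n≤1+n _
    ... | no _  = ℕ.≤-refl
    degrees : ∀ M → length M ≤ degree r v M + (degree b v M + degree g v M)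
    degrees [] = z≤n
    degrees (w ∷ M) with colours (col v w)
    ... | inj₁ e = ℕ.≤-trans (s≤s (degrees M))
      (ℕ.+-mono-≤ (accept M e) (ℕ.+-mono-≤ (grow b w M) (grow g w M)))
    ... | inj₂ (inj₁ e) = ℕ.≤-trans (s≤s (degrees M)) (ℕ.≤-trans
      (ℕ.≤-reflexive (sym (ℕ.+-suc (degree r v M) _)))
      (ℕ.+-mono-≤ (grow r w M) (ℕ.+-mono-≤ (accept M e) (grow g w M))))
    ... | inj₂ (inj₂ e) = ℕ.≤-trans (s≤s (degrees M)) (ℕ.≤-trans
      (ℕ.≤-reflexive (trans (sym (ℕ.+-suc (degree r v M) _)) (cong (degree r v M +_) (sym (ℕ.+-suc (degree b v M) _)))))
      (ℕ.+-mono-≤ (grow r w M) (ℕ.+-mono-≤ (grow b w M) (accept M e))))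

  -- Graphs without P₈, C₆ and C₇.

  IsPath : Fin 3 → List V → List V → Set
  IsPath i L p = Unique p × Linked (E i) p × p ⊆ L

  NoCycle : Fin 3 → ℕ → Set
  NoCycle i n = ∀ x xs → suc (length xs) ≡ n → Unique (x ∷ xs) → ¬ Linked (E i) (x ∷ xs ∷ʳ x)

  -- A longest path in L ends in a set of vertices that meets few edges.
  module LongestPath (i : Fin 3) (noC₆ : NoCycle i 6) (noC₇ : NoCycle i 7) {L : List V} (L! : Unique L)
    -- Removing such a `ps` would cost at most two edges per vertex. A smallest violation of the
    -- bound 2n admits no removal of this sort.
    (irreducible : ∀ ps M → Unique ps → ps ⊆ L → 0 < length ps →
       closedBound (length ps) (length M) ≤ 2 * length ps →
       ¬ (∀ {p w} → p ∈ ps → w ∈ L → E i p w → w ∈ ps ++ M))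
    where

    NoLonger : ℕ → Set
    NoLonger k = ∀ p → length p ≡ suc k → ¬ IsPath i L p

    select : ∀ {base} → Unique base → base ⊆ L → (is : List (Fin (length base))) →
             {True (unique? is)} → Linked (E i) (map (lookup base) is) →
             IsPath i L (map (lookup base) is)
    select {base} base! base⊆ is {is!} link = Unique-select base! is {is!} , link , sub
      where
      sub : map (lookup base) is ⊆ L
      sub v∈ with k , _ , refl ← ∈-map⁻ (lookup base) v∈ = base⊆ (∈-lookup k)

    -- is lists the vertices of a longest path in another order, starting with k.
    closed : ∀ {base} → NoLonger (length base) → Unique base → base ⊆ L →
             ∀ k is → {True (unique? (k ∷ is))} → suc (length is) ≡ length base →
             Linked (E i) (map (lookup base) (k ∷ is)) →
             ∀ {w} → w ∈ L → E i (lookup base k) w → w ∈ base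
    closed {base} longest base! base⊆ k is {is!} len link {w} w∈L vw with w ∈? base
    ... | yes w∈ = w∈
    ... | no w∉  = ⊥-elim (longest (w ∷ map (lookup base) (k ∷ is))
      (cong suc (trans (length-map (lookup base) (k ∷ is)) len))
      (extend (select base! base⊆ (k ∷ is) {is!} link)))
      where
      extend : IsPath i L (map (lookup base) (k ∷ is)) → IsPath i L (w ∷ map (lookup base) (k ∷ is))
      extend (p! , _ , p⊆) =
        ∷-Unique (λ w∈p → w∉ (back w∈p)) p! , E-sym vw ∷ link , λ { (here refl) → w∈L ; (there v∈) → p⊆ v∈ }
        where
        back : w ∈ map (lookup base) (k ∷ is) → w ∈ base
        back w∈p with j , _ , refl ← ∈-map⁻ (lookup base) {xs = k ∷ is} w∈p = ∈-lookup j

    -- `NoLonger k` unfolds to `NoPath (suc k)`, so the lemmas below chain downwards from P₈ to a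
    -- single vertex.
    NoPath : ℕ → Set
    NoPath k = ∀ p → length p ≡ k → ¬ IsPath i L p

    -- A vertex with at most two neighbours is removable.
    threeNeighbours : ∀ {a} b c → a ∈ L → ¬ (∀ {w} → w ∈ L → E i a w → w ∈ a ∷ b ∷ c ∷ [])
    threeNeighbours {a} b c a∈ nbrs =
      irreducible (a ∷ []) (b ∷ c ∷ []) ([] ∷ []) (λ { (here refl) → a∈ }) (s≤s z≤n) ℕ.≤-refl
        λ { (here refl) w∈ aw → nbrs w∈ aw }

    noP₁ : NoLonger 1 → NoPath 1
    noP₁ longest (a ∷ []) refl (u , _ , s) =
      threeNeighbours a a (s (here refl)) λ w∈ aw → widen (closed longest u s (# 0) [] refl [-] w∈ aw)
      where
      widen : a ∷ [] ⊆ a ∷ a ∷ a ∷ []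
      widen (here e) = here e

    noP₂ : NoLonger 2 → NoPath 2
    noP₂ longest (a ∷ b ∷ []) refl (u , ab , s) =
      threeNeighbours b b (s (here refl)) λ w∈ aw → widen (closed longest u s (# 0) (# 1 ∷ []) refl ab w∈ aw)
      where
      widen : a ∷ b ∷ [] ⊆ a ∷ b ∷ b ∷ []
      widen (here e)         = here e
      widen (there (here e)) = there (here e)

    noP₃ : NoLonger 3 → NoPath 3
    noP₃ longest (a ∷ b ∷ c ∷ []) refl (u , abc , s) =
      threeNeighbours b c (s (here refl)) λ w∈ aw → closed longest u s (# 0) (# 1 ∷ # 2 ∷ []) refl abc w∈ aw

    -- If `a` and `d` are joined, turning the four-cycle makes every vertex an end of a longest
    -- path, and the four vertices form a closed set with at most 6 ≤ 8 edges. Otherwise `a` has no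
    -- neighbours but `b` and `c`.
    noP₄ : NoLonger 4 → NoPath 4
    noP₄ longest p@(a ∷ b ∷ c ∷ d ∷ []) refl (u , ab ∷ bc ∷ cd ∷ [-] , s) with E? i a d
    ... | no ¬ad = threeNeighbours b c (s (here refl)) λ w∈ aw →
      narrow aw (closed longest u s (# 0) (# 1 ∷ # 2 ∷ # 3 ∷ []) refl (ab ∷ bc ∷ cd ∷ [-]) w∈ aw)
      where
      narrow : ∀ {w} → E i a w → w ∈ p → w ∈ a ∷ b ∷ c ∷ []
      narrow aw (here e)                            = here e
      narrow aw (there (here e))                    = there (here e)
      narrow aw (there (there (here e)))            = there (there (here e))
      narrow aw (there (there (there (here refl)))) = ⊥-elim (¬ad aw)
    ... | yes ad = irreducible p [] u s (s≤s z≤n) (ℕ.≤ᵇ⇒≤ 6 8 tt) λ v∈ w∈ vw → nbrs v∈ w∈ vw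
      where
      nbrs : ∀ {v w} → v ∈ p → w ∈ L → E i v w → w ∈ p
      nbrs (here refl) =
        closed longest u s (# 0) (# 1 ∷ # 2 ∷ # 3 ∷ []) refl (ab ∷ bc ∷ cd ∷ [-])
      nbrs (there (here refl)) =
        closed longest u s (# 1) (# 2 ∷ # 3 ∷ # 0 ∷ []) refl (bc ∷ cd ∷ E-sym ad ∷ [-])
      nbrs (there (there (here refl))) =
        closed longest u s (# 2) (# 3 ∷ # 0 ∷ # 1 ∷ []) refl (cd ∷ E-sym ad ∷ ab ∷ [-])
      nbrs (there (there (there (here refl)))) =
        closed longest u s (# 3) (# 0 ∷ # 1 ∷ # 2 ∷ []) refl (E-sym ad ∷ ab ∷ bc ∷ [-])

    -- Every vertex of the cycle is an end of a longest path, so the cycle is closed; its at most 10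
    -- edges just meet the bound 2 · 5. For six vertices the same count gives 15 > 12, which is why
    -- C₆ has to be excluded by hypothesis.
    noC₅ : NoLonger 5 → ∀ a b c d e → Unique (a ∷ b ∷ c ∷ d ∷ e ∷ []) → a ∷ b ∷ c ∷ d ∷ e ∷ [] ⊆ L →
           E i a b → E i b c → E i c d → E i d e → ¬ E i e a
    noC₅ longest a b c d e u s ab bc cd de ea =
      irreducible (a ∷ b ∷ c ∷ d ∷ e ∷ []) [] u s (s≤s z≤n) ℕ.≤-refl λ v∈ w∈ vw → nbrs v∈ w∈ vw
      where
      nbrs : ∀ {v w} → v ∈ a ∷ b ∷ c ∷ d ∷ e ∷ [] → w ∈ L → E i v w → w ∈ a ∷ b ∷ c ∷ d ∷ e ∷ []
      nbrs (here refl) =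
        closed longest u s (# 0) (# 1 ∷ # 2 ∷ # 3 ∷ # 4 ∷ []) refl (ab ∷ bc ∷ cd ∷ de ∷ [-])
      nbrs (there (here refl)) =
        closed longest u s (# 1) (# 2 ∷ # 3 ∷ # 4 ∷ # 0 ∷ []) refl (bc ∷ cd ∷ de ∷ ea ∷ [-])
      nbrs (there (there (here refl))) =
        closed longest u s (# 2) (# 3 ∷ # 4 ∷ # 0 ∷ # 1 ∷ []) refl (cd ∷ de ∷ ea ∷ ab ∷ [-])
      nbrs (there (there (there (here refl)))) =
        closed longest u s (# 3) (# 4 ∷ # 0 ∷ # 1 ∷ # 2 ∷ []) refl (de ∷ ea ∷ ab ∷ bc ∷ [-])
      nbrs (there (there (there (there (here refl))))) =
        closed longest u s (# 4) (# 0 ∷ # 1 ∷ # 2 ∷ # 3 ∷ []) refl (ea ∷ ab ∷ bc ∷ cd ∷ [-])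

    -- The ends are not joined, and neither is removable, so `a` is joined to `c` and `d`, and `e`
    -- to `b`. Then a c b e d is a five-cycle.
    noP₅ : NoLonger 5 → NoPath 5
    noP₅ longest p@(a ∷ b ∷ c ∷ d ∷ e ∷ []) refl (u , ab ∷ bc ∷ cd ∷ de ∷ [-] , s) =
      thirdNeighbours (E? i a c) (E? i a d) (E? i e b)
      where
      ¬ea : ¬ E i e a
      ¬ea = noC₅ longest a b c d e u s ab bc cd de
      nbrs-a : ∀ {w} → w ∈ L → E i a w → w ∈ p
      nbrs-a = closed longest u s (# 0) (# 1 ∷ # 2 ∷ # 3 ∷ # 4 ∷ []) refl (ab ∷ bc ∷ cd ∷ de ∷ [-])
      nbrs-e : ∀ {w} → w ∈ L → E i e w → w ∈ p
      nbrs-e = closed longest u s (# 4) (# 3 ∷ # 2 ∷ # 1 ∷ # 0 ∷ []) refl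
        (E-sym de ∷ E-sym cd ∷ E-sym bc ∷ E-sym ab ∷ [-])
      without-c : ¬ E i a c → ∀ {w} → E i a w → w ∈ p → w ∈ a ∷ b ∷ d ∷ []
      without-c ¬ac aw (here e)                                    = here e
      without-c ¬ac aw (there (here e))                            = there (here e)
      without-c ¬ac aw (there (there (here refl)))                 = ⊥-elim (¬ac aw)
      without-c ¬ac aw (there (there (there (here e))))            = there (there (here e))
      without-c ¬ac aw (there (there (there (there (here refl))))) = ⊥-elim (¬ea (E-sym aw))
      without-b : ¬ E i e b → ∀ {w} → E i e w → w ∈ p → w ∈ e ∷ c ∷ d ∷ []
      without-b ¬eb ew (here refl)                              = ⊥-elim (¬ea ew)
      without-b ¬eb ew (there (here refl))                      = ⊥-elim (¬eb ew)
      without-b ¬eb ew (there (there (here e)))                 = there (here e)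
      without-b ¬eb ew (there (there (there (here e))))         = there (there (here e))
      without-b ¬eb ew (there (there (there (there (here e))))) = here e
      without-d : ¬ E i a d → ∀ {w} → E i a w → w ∈ p → w ∈ a ∷ b ∷ c ∷ []
      without-d ¬ad aw (here e)                                    = here e
      without-d ¬ad aw (there (here e))                            = there (here e)
      without-d ¬ad aw (there (there (here e)))                    = there (there (here e))
      without-d ¬ad aw (there (there (there (here refl))))         = ⊥-elim (¬ad aw)
      without-d ¬ad aw (there (there (there (there (here refl))))) = ⊥-elim (¬ea (E-sym aw))
      thirdNeighbours : Dec (E i a c) → Dec (E i a d) → Dec (E i e b) → ⊥
      thirdNeighbours (no ¬ac) _ _ =
        threeNeighbours b d (s (here refl)) λ w∈ aw → without-c ¬ac aw (nbrs-a w∈ aw)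
      thirdNeighbours (yes _) (no ¬ad) _ =
        threeNeighbours b c (s (here refl)) λ w∈ aw → without-d ¬ad aw (nbrs-a w∈ aw)
      thirdNeighbours (yes _) (yes _) (no ¬eb) =
        threeNeighbours c d (s (there (there (there (there (here refl)))))) λ w∈ ew → without-b ¬eb ew (nbrs-e w∈ ew)
      thirdNeighbours (yes ac) (yes ad) (yes eb) =
        noC₅ longest a c b e d (Unique-select u (# 0 ∷ # 2 ∷ # 1 ∷ # 4 ∷ # 3 ∷ []))
          (proj₂ (proj₂ (select u s (# 0 ∷ # 2 ∷ # 1 ∷ # 4 ∷ # 3 ∷ []) (ac ∷ E-sym bc ∷ E-sym eb ∷ E-sym de ∷ [-]))))
          ac (E-sym bc) (E-sym eb) (E-sym de) (E-sym ad)

    twoOfThree : ∀ {A B C : Set} → Dec A → Dec B → Dec C → ¬ (¬ A × ¬ B) → ¬ (¬ A × ¬ C) → ¬ (¬ B × ¬ C) →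
                 A × B ⊎ A × C ⊎ B × C
    twoOfThree (yes a) (yes b) _       _ _ _ = inj₁ (a , b)
    twoOfThree (yes a) (no _)  (yes c) _ _ _ = inj₂ (inj₁ (a , c))
    twoOfThree (no _)  (yes b) (yes c) _ _ _ = inj₂ (inj₂ (b , c))
    twoOfThree (no ¬a) (no ¬b) _       n _ _ = ⊥-elim (n (¬a , ¬b))
    twoOfThree (no ¬a) (yes _) (no ¬c) _ n _ = ⊥-elim (n (¬a , ¬c))
    twoOfThree (yes _) (no ¬b) (no ¬c) _ _ n = ⊥-elim (n (¬b , ¬c))

    -- The end a of a longest path has, besides b, two of the neighbours c, d, e.
    endNeighbours : ∀ a b c d e → a ∈ L → (∀ {w} → w ∈ L → E i a w → w ∈ a ∷ b ∷ c ∷ d ∷ e ∷ []) →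
                    E i a c × E i a d ⊎ E i a c × E i a e ⊎ E i a d × E i a e
    endNeighbours a b c d e a∈ nbrs = twoOfThree (E? i a c) (E? i a d) (E? i a e)
      (λ (¬c , ¬d) → threeNeighbours b e a∈ λ w∈ aw → without-cd ¬c ¬d aw (nbrs w∈ aw))
      (λ (¬c , ¬e) → threeNeighbours b d a∈ λ w∈ aw → without-ce ¬c ¬e aw (nbrs w∈ aw))
      (λ (¬d , ¬e) → threeNeighbours b c a∈ λ w∈ aw → without-de ¬d ¬e aw (nbrs w∈ aw))
      where
      without-cd : ¬ E i a c → ¬ E i a d → ∀ {w} → E i a w → w ∈ a ∷ b ∷ c ∷ d ∷ e ∷ [] → w ∈ a ∷ b ∷ e ∷ []
      without-cd ¬c ¬d aw (here e)                                = here e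
      without-cd ¬c ¬d aw (there (here e))                        = there (here e)
      without-cd ¬c ¬d aw (there (there (here refl)))             = ⊥-elim (¬c aw)
      without-cd ¬c ¬d aw (there (there (there (here refl))))     = ⊥-elim (¬d aw)
      without-cd ¬c ¬d aw (there (there (there (there (here e))))) = there (there (here e))
      without-ce : ¬ E i a c → ¬ E i a e → ∀ {w} → E i a w → w ∈ a ∷ b ∷ c ∷ d ∷ e ∷ [] → w ∈ a ∷ b ∷ d ∷ []
      without-ce ¬c ¬e aw (here e)                                    = here e
      without-ce ¬c ¬e aw (there (here e))                            = there (here e)
      without-ce ¬c ¬e aw (there (there (here refl)))                 = ⊥-elim (¬c aw)
      without-ce ¬c ¬e aw (there (there (there (here e))))            = there (there (here e))
      without-ce ¬c ¬e aw (there (there (there (there (here refl))))) = ⊥-elim (¬e aw)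
      without-de : ¬ E i a d → ¬ E i a e → ∀ {w} → E i a w → w ∈ a ∷ b ∷ c ∷ d ∷ e ∷ [] → w ∈ a ∷ b ∷ c ∷ []
      without-de ¬d ¬e aw (here e)                                    = here e
      without-de ¬d ¬e aw (there (here e))                            = there (here e)
      without-de ¬d ¬e aw (there (there (here e)))                    = there (there (here e))
      without-de ¬d ¬e aw (there (there (there (here refl))))         = ⊥-elim (¬d aw)
      without-de ¬d ¬e aw (there (there (there (there (here refl))))) = ⊥-elim (¬e aw)

    cycle₆ : ∀ {base} → Unique base → (j₁ j₂ j₃ j₄ j₅ j₆ : Fin (length base)) →
             {True (unique? (j₁ ∷ j₂ ∷ j₃ ∷ j₄ ∷ j₅ ∷ j₆ ∷ []))} →
             ¬ Linked (E i) (map (lookup base) (j₁ ∷ j₂ ∷ j₃ ∷ j₄ ∷ j₅ ∷ j₆ ∷ j₁ ∷ []))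
    cycle₆ u j₁ j₂ j₃ j₄ j₅ j₆ {js!} = noC₆ _ _ refl (Unique-select u (j₁ ∷ j₂ ∷ j₃ ∷ j₄ ∷ j₅ ∷ j₆ ∷ []) {js!})

    cycle₇ : ∀ {base} → Unique base → (j₁ j₂ j₃ j₄ j₅ j₆ j₇ : Fin (length base)) →
             {True (unique? (j₁ ∷ j₂ ∷ j₃ ∷ j₄ ∷ j₅ ∷ j₆ ∷ j₇ ∷ []))} →
             ¬ Linked (E i) (map (lookup base) (j₁ ∷ j₂ ∷ j₃ ∷ j₄ ∷ j₅ ∷ j₆ ∷ j₇ ∷ j₁ ∷ []))
    cycle₇ u j₁ j₂ j₃ j₄ j₅ j₆ j₇ {js!} = noC₇ _ _ refl (Unique-select u (j₁ ∷ j₂ ∷ j₃ ∷ j₄ ∷ j₅ ∷ j₆ ∷ j₇ ∷ []) {js!})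

    -- The chords pair off as ac with fb, ad with fc, ae with fd, and each pair crosses so as to
    -- close a six-cycle. Each end has two of its three chords, so some pair occurs.
    noP₆ : NoLonger 6 → NoPath 6
    noP₆ longest p@(a ∷ b ∷ c ∷ d ∷ e ∷ f ∷ []) refl (u , ab ∷ bc ∷ cd ∷ de ∷ ef ∷ [-] , s) = clash
      (endNeighbours a b c d e (s (here refl)) λ w∈ aw → narrow-a aw (closed longest u s
        (# 0) (# 1 ∷ # 2 ∷ # 3 ∷ # 4 ∷ # 5 ∷ []) refl (ab ∷ bc ∷ cd ∷ de ∷ ef ∷ [-]) w∈ aw))
      (endNeighbours f e d c b (s (there (there (there (there (there (here refl))))))) λ w∈ fw → narrow-f fw (closed longest u s
        (# 5) (# 4 ∷ # 3 ∷ # 2 ∷ # 1 ∷ # 0 ∷ []) refl (E-sym ef ∷ E-sym de ∷ E-sym cd ∷ E-sym bc ∷ E-sym ab ∷ [-]) w∈ fw))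
      where
      ¬af : ¬ E i a f
      ¬af af = cycle₆ u (# 0) (# 1) (# 2) (# 3) (# 4) (# 5) (ab ∷ bc ∷ cd ∷ de ∷ ef ∷ E-sym af ∷ [-])
      narrow-a : ∀ {w} → E i a w → w ∈ p → w ∈ a ∷ b ∷ c ∷ d ∷ e ∷ []
      narrow-a aw w∈ with ∈-++⁻ (a ∷ b ∷ c ∷ d ∷ e ∷ []) {f ∷ []} w∈
      ... | inj₁ w∈         = w∈
      ... | inj₂ (here refl) = ⊥-elim (¬af aw)
      narrow-f : ∀ {w} → E i f w → w ∈ p → w ∈ f ∷ e ∷ d ∷ c ∷ b ∷ []
      narrow-f fw (here refl)                                        = ⊥-elim (¬af (E-sym fw))
      narrow-f fw (there (here e))                                   = there (there (there (there (here e))))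
      narrow-f fw (there (there (here e)))                           = there (there (there (here e)))
      narrow-f fw (there (there (there (here e))))                   = there (there (here e))
      narrow-f fw (there (there (there (there (here e)))))           = there (here e)
      narrow-f fw (there (there (there (there (there (here e))))))   = here e
      ac-fb : E i a c → ¬ E i f b
      ac-fb ac fb = cycle₆ u (# 0) (# 2) (# 3) (# 4) (# 5) (# 1) (ac ∷ cd ∷ de ∷ ef ∷ fb ∷ E-sym ab ∷ [-])
      ad-fc : E i a d → ¬ E i f c
      ad-fc ad fc = cycle₆ u (# 0) (# 3) (# 4) (# 5) (# 2) (# 1) (ad ∷ de ∷ ef ∷ fc ∷ E-sym bc ∷ E-sym ab ∷ [-])
      ae-fd : E i a e → ¬ E i f d
      ae-fd ae fd = cycle₆ u (# 0) (# 4) (# 5) (# 3) (# 2) (# 1) (ae ∷ ef ∷ fd ∷ E-sym cd ∷ E-sym bc ∷ E-sym ab ∷ [-])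
      clash : E i a c × E i a d ⊎ E i a c × E i a e ⊎ E i a d × E i a e →
              E i f d × E i f c ⊎ E i f d × E i f b ⊎ E i f c × E i f b → ⊥
      clash (inj₁ (ac , ad))        (inj₁ (fd , fc))        = ad-fc ad fc
      clash (inj₁ (ac , ad))        (inj₂ (inj₁ (fd , fb))) = ac-fb ac fb
      clash (inj₁ (ac , ad))        (inj₂ (inj₂ (fc , fb))) = ac-fb ac fb
      clash (inj₂ (inj₁ (ac , ae))) (inj₁ (fd , fc))        = ae-fd ae fd
      clash (inj₂ (inj₁ (ac , ae))) (inj₂ (inj₁ (fd , fb))) = ac-fb ac fb
      clash (inj₂ (inj₁ (ac , ae))) (inj₂ (inj₂ (fc , fb))) = ac-fb ac fb
      clash (inj₂ (inj₂ (ad , ae))) (inj₁ (fd , fc))        = ad-fc ad fc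
      clash (inj₂ (inj₂ (ad , ae))) (inj₂ (inj₁ (fd , fb))) = ae-fd ae fd
      clash (inj₂ (inj₂ (ad , ae))) (inj₂ (inj₂ (fc , fb))) = ad-fc ad fc

    NonNeighbours : V → V → V → V → Set
    NonNeighbours a e f g = ¬ E i a e × ¬ E i a f × ¬ E i a g

    -- For use with three orders of the first three vertices, each followed by the same d e f g.
    farFromEnd : ∀ a b c d e f g → Unique (a ∷ b ∷ c ∷ d ∷ e ∷ f ∷ g ∷ []) →
                 Linked (E i) (a ∷ b ∷ c ∷ d ∷ e ∷ f ∷ g ∷ []) → E i g d → NonNeighbours a e f g
    farFromEnd a b c d e f g u (ab ∷ bc ∷ cd ∷ de ∷ ef ∷ fg ∷ [-]) gd =
      (λ ae → cycle₇ u (# 0) (# 4) (# 5) (# 6) (# 3) (# 2) (# 1)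
                (ae ∷ ef ∷ fg ∷ gd ∷ E-sym cd ∷ E-sym bc ∷ E-sym ab ∷ [-])) ,
      (λ af → cycle₆ u (# 0) (# 1) (# 2) (# 3) (# 4) (# 5) (ab ∷ bc ∷ cd ∷ de ∷ ef ∷ E-sym af ∷ [-])) ,
      (λ ag → cycle₇ u (# 0) (# 1) (# 2) (# 3) (# 4) (# 5) (# 6) (ab ∷ bc ∷ cd ∷ de ∷ ef ∷ fg ∷ E-sym ag ∷ [-]))

    -- Crossing chords close a C₆ or a C₇ unless `a` has the chords to `c` and `d`, and `g` those to
    -- `e` and `d`. In that case a, b, c hang on `d` alone and meet at most 6 = 2 · 3 edges.
    noP₇ : NoLonger 7 → NoPath 7
    noP₇ longest p@(a ∷ b ∷ c ∷ d ∷ e ∷ f ∷ g ∷ []) refl (u , link@(ab ∷ bc ∷ cd ∷ de ∷ ef ∷ fg ∷ [-]) , s) = clash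
      (endNeighbours a b c d e (s (here refl)) λ w∈ aw → narrow-a aw (nbrs-a w∈ aw))
      (endNeighbours g f e d c (s (there (there (there (there (there (there (here refl)))))))) λ w∈ gw → narrow-g gw (closed longest u s
        (# 6) (# 5 ∷ # 4 ∷ # 3 ∷ # 2 ∷ # 1 ∷ # 0 ∷ []) refl
        (E-sym fg ∷ E-sym ef ∷ E-sym de ∷ E-sym cd ∷ E-sym bc ∷ E-sym ab ∷ [-]) w∈ gw))
      where
      nbrs-a : ∀ {w} → w ∈ L → E i a w → w ∈ p
      nbrs-a = closed longest u s (# 0) (# 1 ∷ # 2 ∷ # 3 ∷ # 4 ∷ # 5 ∷ # 6 ∷ []) refl link
      ¬ag : ¬ E i a g
      ¬ag ag = cycle₇ u (# 0) (# 1) (# 2) (# 3) (# 4) (# 5) (# 6) (ab ∷ bc ∷ cd ∷ de ∷ ef ∷ fg ∷ E-sym ag ∷ [-])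
      ¬af : ¬ E i a f
      ¬af af = cycle₆ u (# 0) (# 1) (# 2) (# 3) (# 4) (# 5) (ab ∷ bc ∷ cd ∷ de ∷ ef ∷ E-sym af ∷ [-])
      ¬gb : ¬ E i g b
      ¬gb gb = cycle₆ u (# 1) (# 2) (# 3) (# 4) (# 5) (# 6) (bc ∷ cd ∷ de ∷ ef ∷ fg ∷ gb ∷ [-])
      narrow-a : ∀ {w} → E i a w → w ∈ p → w ∈ a ∷ b ∷ c ∷ d ∷ e ∷ []
      narrow-a aw w∈ with ∈-++⁻ (a ∷ b ∷ c ∷ d ∷ e ∷ []) {f ∷ g ∷ []} w∈
      ... | inj₁ w∈                  = w∈
      ... | inj₂ (here refl)         = ⊥-elim (¬af aw)
      ... | inj₂ (there (here refl)) = ⊥-elim (¬ag aw)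
      narrow-g : ∀ {w} → E i g w → w ∈ p → w ∈ g ∷ f ∷ e ∷ d ∷ c ∷ []
      narrow-g gw (here refl)                                                = ⊥-elim (¬ag (E-sym gw))
      narrow-g gw (there (here refl))                                        = ⊥-elim (¬gb gw)
      narrow-g gw (there (there (here e)))                                   = there (there (there (there (here e))))
      narrow-g gw (there (there (there (here e))))                           = there (there (there (here e)))
      narrow-g gw (there (there (there (there (here e)))))                   = there (there (here e))
      narrow-g gw (there (there (there (there (there (here e))))))           = there (here e)
      narrow-g gw (there (there (there (there (there (there (here e)))))))   = here e
      ad-gc : E i a d → ¬ E i g c
      ad-gc ad gc = cycle₇ u (# 0) (# 3) (# 4) (# 5) (# 6) (# 2) (# 1)
        (ad ∷ de ∷ ef ∷ fg ∷ gc ∷ E-sym bc ∷ E-sym ab ∷ [-])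
      ae-gd : E i a e → ¬ E i g d
      ae-gd ae gd = cycle₇ u (# 0) (# 4) (# 5) (# 6) (# 3) (# 2) (# 1)
        (ae ∷ ef ∷ fg ∷ gd ∷ E-sym cd ∷ E-sym bc ∷ E-sym ab ∷ [-])
      ae-gc : E i a e → ¬ E i g c
      ae-gc ae gc = cycle₆ u (# 0) (# 4) (# 5) (# 6) (# 2) (# 1) (ae ∷ ef ∷ fg ∷ gc ∷ E-sym bc ∷ E-sym ab ∷ [-])

      -- Here a, b, c are all ends of longest paths, and adjacent to nothing but
      -- each other and d.
      cutVertex : E i a c → E i a d → E i g d → ⊥
      cutVertex ac ad gd = irreducible (a ∷ b ∷ c ∷ []) (d ∷ []) (Unique-++⁻ˡ (a ∷ b ∷ c ∷ []) u)
        (λ v∈ → s (∈-++⁺ˡ v∈)) (s≤s z≤n) ℕ.≤-refl nbrs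
        where
        abcd : ∀ {v w} → NonNeighbours v e f g → E i v w → w ∈ p → w ∈ a ∷ b ∷ c ∷ d ∷ []
        abcd (¬e , ¬f , ¬g) vw w∈ with ∈-++⁻ (a ∷ b ∷ c ∷ d ∷ []) {e ∷ f ∷ g ∷ []} w∈
        ... | inj₁ w∈                          = w∈
        ... | inj₂ (here refl)                 = ⊥-elim (¬e vw)
        ... | inj₂ (there (here refl))         = ⊥-elim (¬f vw)
        ... | inj₂ (there (there (here refl))) = ⊥-elim (¬g vw)
        bacdefg : Linked (E i) (b ∷ a ∷ c ∷ d ∷ e ∷ f ∷ g ∷ [])
        bacdefg = E-sym ab ∷ ac ∷ cd ∷ de ∷ ef ∷ fg ∷ [-]
        cbadefg : Linked (E i) (c ∷ b ∷ a ∷ d ∷ e ∷ f ∷ g ∷ [])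
        cbadefg = E-sym bc ∷ E-sym ab ∷ ad ∷ de ∷ ef ∷ fg ∷ [-]
        nbrs : ∀ {v w} → v ∈ a ∷ b ∷ c ∷ [] → w ∈ L → E i v w → w ∈ a ∷ b ∷ c ∷ d ∷ []
        nbrs (here refl) w∈ aw = abcd (farFromEnd a b c d e f g u link gd) aw (nbrs-a w∈ aw)
        nbrs (there (here refl)) w∈ bw = abcd
          (farFromEnd b a c d e f g (Unique-select u (# 1 ∷ # 0 ∷ # 2 ∷ # 3 ∷ # 4 ∷ # 5 ∷ # 6 ∷ [])) bacdefg gd) bw
          (closed longest u s (# 1) (# 0 ∷ # 2 ∷ # 3 ∷ # 4 ∷ # 5 ∷ # 6 ∷ []) refl bacdefg w∈ bw)
        nbrs (there (there (here refl))) w∈ cw = abcd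
          (farFromEnd c b a d e f g (Unique-select u (# 2 ∷ # 1 ∷ # 0 ∷ # 3 ∷ # 4 ∷ # 5 ∷ # 6 ∷ [])) cbadefg gd) cw
          (closed longest u s (# 2) (# 1 ∷ # 0 ∷ # 3 ∷ # 4 ∷ # 5 ∷ # 6 ∷ []) refl cbadefg w∈ cw)

      clash : E i a c × E i a d ⊎ E i a c × E i a e ⊎ E i a d × E i a e →
              E i g e × E i g d ⊎ E i g e × E i g c ⊎ E i g d × E i g c → ⊥
      clash (inj₁ (ac , ad))        (inj₁ (ge , gd))        = cutVertex ac ad gd
      clash (inj₁ (ac , ad))        (inj₂ (inj₁ (ge , gc))) = ad-gc ad gc
      clash (inj₁ (ac , ad))        (inj₂ (inj₂ (gd , gc))) = ad-gc ad gc
      clash (inj₂ (inj₁ (ac , ae))) (inj₁ (ge , gd))        = ae-gd ae gd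
      clash (inj₂ (inj₁ (ac , ae))) (inj₂ (inj₁ (ge , gc))) = ae-gc ae gc
      clash (inj₂ (inj₁ (ac , ae))) (inj₂ (inj₂ (gd , gc))) = ae-gc ae gc
      clash (inj₂ (inj₂ (ad , ae))) (inj₁ (ge , gd))        = ae-gd ae gd
      clash (inj₂ (inj₂ (ad , ae))) (inj₂ (inj₁ (ge , gc))) = ad-gc ad gc
      clash (inj₂ (inj₂ (ad , ae))) (inj₂ (inj₂ (gd , gc))) = ad-gc ad gc

    empty : NoPath 1
    empty = noP₁ (noP₂ (noP₃ (noP₄ (noP₅ (noP₆ (noP₇ λ p len (p! , link , _) → noP₈ i p p! link len))))))

  -- Induction on the length yields `irreducible`: what remains after removing `ps` obeys the bound,
  -- and then so would `L`.
  edges≤2length : ∀ i → NoCycle i 6 → NoCycle i 7 → ∀ L → Unique L → edges i L ≤ 2 * length L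
  edges≤2length i noC₆ noC₇ L = bounded (length L) L ℕ.≤-refl
    where
    bounded : ∀ n L → length L ≤ n → Unique L → edges i L ≤ 2 * length L
    bounded n [] _ _ = z≤n
    bounded (suc n) L@(v ∷ _) (s≤s L≤n) L! = decidable-stable (edges i L ℕ.≤? 2 * length L) λ many →
      LongestPath.empty i noC₆ noC₇ L! (irreducible many) (v ∷ []) refl
        ([] ∷ [] , [-] , λ { (here refl) → here refl })
      where
      irreducible : ¬ edges i L ≤ 2 * length L → ∀ ps M → Unique ps → ps ⊆ L → 0 < length ps →
                    closedBound (length ps) (length M) ≤ 2 * length ps →
                    ¬ (∀ {p w} → p ∈ ps → w ∈ L → E i p w → w ∈ ps ++ M)
      irreducible many ps@(p ∷ ps′) M ps! ps⊆ _ few nbrs = remove (Unique-⊆⇒↭ ps! ps⊆)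
        where
        remove : (∃ λ L′ → L ↭ ps ++ L′) → ⊥
        remove (L′ , q) = many (begin
          edges i L                                  ≡⟨ edges-↭ i q ⟩
          edges i (ps ++ L′)                         ≤⟨ edges-closed i ps M (Unique-resp-↭ q L!)
                                                          (λ p∈ w∈ → nbrs p∈ (∈-resp-↭ (↭-sym q) w∈)) ⟩
          closedBound (length ps) (length M) + edges i L′
                                                     ≤⟨ ℕ.+-mono-≤ few (bounded n L′ L′≤n
                                                          (Unique-++⁻ʳ ps (Unique-resp-↭ q L!))) ⟩
          2 * length ps + 2 * length L′              ≡⟨ sym (ℕ.*-distribˡ-+ 2 (length ps) (length L′)) ⟩
          2 * (length ps + length L′)                ≡⟨ cong (2 *_) (sym len) ⟩
          2 * length L                               ∎)
          where
          open ℕ.≤-Reasoning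
          len : length L ≡ length ps + length L′
          len = trans (↭-length q) (length-++ ps)
          L′≤n : length L′ ≤ n
          L′≤n = ℕ.≤-trans (ℕ.m≤n+m (length L′) (length ps′))
                   (subst (_≤ n) (ℕ.suc-injective len) L≤n)

  -- The structure around a six-cycle.

  -- So every edge of colour r meets S, or lies inside Q, or lies inside Z.
  record Covered (r : Fin 3) : Set where
    field
      {S Q Z W} : List V
      vertices  : allFin 14 ↭ (S ++ Q) ++ (Z ++ W)
      S-length  : length S ≡ 3
      Q-length  : length Q ≡ 3
      Z-length  : length Z ≤ 5
      Z-closed  : ∀ {z v} → z ∈ Z → v ∉ Z → ¬ E r z v
      Q-W       : ∀ {q w} → q ∈ Q → w ∈ W → ¬ E r q w
      W-W       : ∀ {v w} → v ∈ W → w ∈ W → v ≢ w → ¬ E r v w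

  -- The six propositions sit around a hexagon, and those that hold form an independent set. The
  -- maximal ones are the two alternating triples and the three pairs of opposite corners; each
  -- disjunct names three corners that avoid one of these five sets.
  independentTriple : ∀ {A B C D F G : Set} → Dec A → Dec B → Dec C → Dec D → Dec F → Dec G →
    ¬ (A × B) → ¬ (B × C) → ¬ (C × D) → ¬ (D × F) → ¬ (F × G) → ¬ (G × A) →
    (¬ A × ¬ C × ¬ F) ⊎ (¬ B × ¬ D × ¬ G) ⊎ (¬ B × ¬ C × ¬ F) ⊎ (¬ B × ¬ D × ¬ F) ⊎ (¬ A × ¬ C × ¬ D)
  independentTriple (no ¬a) b? (no ¬c) d? (no ¬f) g? _ _ _ _ _ _ = inj₁ (¬a , ¬c , ¬f)
  independentTriple (yes a) b? c? (no ¬d) f? g? ab bc cd df fg ga =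
    inj₂ (inj₁ ((λ b → ab (a , b)) , ¬d , (λ g → ga (g , a))))
  independentTriple (yes a) b? c? (yes d) f? g? ab bc cd df fg ga =
    inj₂ (inj₂ (inj₁ ((λ b → ab (a , b)) , (λ c → cd (c , d)) , (λ f → df (d , f)))))
  independentTriple (no ¬a) b? (yes c) d? f? (no ¬g) ab bc cd df fg ga =
    inj₂ (inj₁ ((λ b → bc (b , c)) , (λ d → cd (c , d)) , ¬g))
  independentTriple (no ¬a) b? (yes c) d? f? (yes g) ab bc cd df fg ga =
    inj₂ (inj₂ (inj₂ (inj₁ ((λ b → bc (b , c)) , (λ d → cd (c , d)) , (λ f → fg (f , g))))))
  independentTriple (no ¬a) (no ¬b) (no ¬c) d? (yes f) g? ab bc cd df fg ga =
    inj₂ (inj₁ (¬b , (λ d → df (d , f)) , (λ g → fg (f , g))))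
  independentTriple (no ¬a) (yes b) (no ¬c) d? (yes f) g? ab bc cd df fg ga =
    inj₂ (inj₂ (inj₂ (inj₂ (¬a , ¬c , (λ d → df (d , f))))))

  next : Fin 6 → Fin 6
  next zero                               = # 1
  next (suc zero)                         = # 2
  next (suc (suc zero))                   = # 3
  next (suc (suc (suc zero)))             = # 4
  next (suc (suc (suc (suc zero))))       = # 5
  next (suc (suc (suc (suc (suc zero))))) = # 0

  -- With the six cycle vertices added to `w`, the exceptional cases split the fourteen vertices
  -- into 6 + 8, 7 + 7 and 8 + 6.
  sizesUpTo5 : ∀ z w → z + w ≡ 8 → z ≤ 5 ⊎ (z ≡ 6 × w ≡ 2) ⊎ (z ≡ 7 × w ≡ 1) ⊎ (z ≡ 8 × w ≡ 0)
  sizesUpTo5 z 0 eq = inj₂ (inj₂ (inj₂ (trans (sym (ℕ.+-identityʳ z)) eq , refl)))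
  sizesUpTo5 z 1 eq = inj₂ (inj₂ (inj₁ (ℕ.+-cancelʳ-≡ 1 z 7 eq , refl)))
  sizesUpTo5 z 2 eq = inj₂ (inj₁ (ℕ.+-cancelʳ-≡ 2 z 6 eq , refl))
  sizesUpTo5 z (suc (suc (suc w))) eq = inj₁ (ℕ.+-cancelʳ-≤ 3 z 5
    (ℕ.≤-trans (ℕ.+-monoʳ-≤ z (s≤s (s≤s (s≤s z≤n)))) (ℕ.≤-reflexive eq)))

  module Cycles {r b g : Fin 3} (colours : ∀ i → i ≡ r ⊎ i ≡ b ⊎ i ≡ g) where

    open TwoColours colours

    complement : ∀ {xs} → Unique xs → ∃ λ ys → allFin 14 ↭ xs ++ ys
    complement xs! = Unique-⊆⇒↭ xs! (λ {v} _ → ∈-allFin v)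

    complement-! : ∀ {xs} → allFin 14 ↭ xs → Unique xs
    complement-! p = Unique-resp-↭ p (allFin⁺ 14)

    complement-length : ∀ xs {ys} → allFin 14 ↭ xs ++ ys → length xs + length ys ≡ 14
    complement-length xs p = sym (trans (↭-length p) (length-++ xs))

    -- A red edge leaving the cycle, continued once around it, is a red P₈. So the cycle and the
    -- other seven vertices have no red edge between them.
    noC₇ : NoCycle r 7
    noC₇ c₀ (c₁ ∷ c₂ ∷ c₃ ∷ c₄ ∷ c₅ ∷ c₆ ∷ []) refl c! (e₀ ∷ e₁ ∷ e₂ ∷ e₃ ∷ e₄ ∷ e₅ ∷ e₆ ∷ [-])
      with ys , p ← complement c! =
      noBipartite₇₇ (complement-! p) refl (ℕ.+-cancelˡ-≡ 7 _ 7 (complement-length C p)) nored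
      where
      C : List V
      C = c₀ ∷ c₁ ∷ c₂ ∷ c₃ ∷ c₄ ∷ c₅ ∷ c₆ ∷ []
      nored : NoRed C ys
      nored {x} {y} x∈ y∈ xy = absurd x∈ xy
        where
        u : Unique (y ∷ C)
        u = ∷-Unique (λ y∈C → Unique-++⇒Disjoint C (complement-! p) (y∈C , y∈)) c!
        absurd : ∀ {x} → x ∈ C → ¬ E r x y
        absurd (here refl) xy =
          noP₈-select r u (# 0 ∷ # 1 ∷ # 2 ∷ # 3 ∷ # 4 ∷ # 5 ∷ # 6 ∷ # 7 ∷ []) refl
            (E-sym xy ∷ e₀ ∷ e₁ ∷ e₂ ∷ e₃ ∷ e₄ ∷ e₅ ∷ [-])
        absurd (there (here refl)) xy =
          noP₈-select r u (# 0 ∷ # 2 ∷ # 3 ∷ # 4 ∷ # 5 ∷ # 6 ∷ # 7 ∷ # 1 ∷ []) refl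
            (E-sym xy ∷ e₁ ∷ e₂ ∷ e₃ ∷ e₄ ∷ e₅ ∷ e₆ ∷ [-])
        absurd (there (there (here refl))) xy =
          noP₈-select r u (# 0 ∷ # 3 ∷ # 4 ∷ # 5 ∷ # 6 ∷ # 7 ∷ # 1 ∷ # 2 ∷ []) refl
            (E-sym xy ∷ e₂ ∷ e₃ ∷ e₄ ∷ e₅ ∷ e₆ ∷ e₀ ∷ [-])
        absurd (there (there (there (here refl)))) xy =
          noP₈-select r u (# 0 ∷ # 4 ∷ # 5 ∷ # 6 ∷ # 7 ∷ # 1 ∷ # 2 ∷ # 3 ∷ []) refl
            (E-sym xy ∷ e₃ ∷ e₄ ∷ e₅ ∷ e₆ ∷ e₀ ∷ e₁ ∷ [-])
        absurd (there (there (there (there (here refl))))) xy =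
          noP₈-select r u (# 0 ∷ # 5 ∷ # 6 ∷ # 7 ∷ # 1 ∷ # 2 ∷ # 3 ∷ # 4 ∷ []) refl
            (E-sym xy ∷ e₄ ∷ e₅ ∷ e₆ ∷ e₀ ∷ e₁ ∷ e₂ ∷ [-])
        absurd (there (there (there (there (there (here refl)))))) xy =
          noP₈-select r u (# 0 ∷ # 6 ∷ # 7 ∷ # 1 ∷ # 2 ∷ # 3 ∷ # 4 ∷ # 5 ∷ []) refl
            (E-sym xy ∷ e₅ ∷ e₆ ∷ e₀ ∷ e₁ ∷ e₂ ∷ e₃ ∷ [-])
        absurd (there (there (there (there (there (there (here refl))))))) xy =
          noP₈-select r u (# 0 ∷ # 7 ∷ # 1 ∷ # 2 ∷ # 3 ∷ # 4 ∷ # 5 ∷ # 6 ∷ []) refl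
            (E-sym xy ∷ e₆ ∷ e₀ ∷ e₁ ∷ e₂ ∷ e₃ ∷ e₄ ∷ [-])

    module _ {c₀ c₁ c₂ c₃ c₄ c₅ : V} (c! : Unique (c₀ ∷ c₁ ∷ c₂ ∷ c₃ ∷ c₄ ∷ c₅ ∷ []))
      (e₀ : E r c₀ c₁) (e₁ : E r c₁ c₂) (e₂ : E r c₂ c₃) (e₃ : E r c₃ c₄) (e₄ : E r c₄ c₅) (e₅ : E r c₅ c₀)
      where

      private
        C : List V
        C = c₀ ∷ c₁ ∷ c₂ ∷ c₃ ∷ c₄ ∷ c₅ ∷ []

      -- The path v w enters the cycle and runs through all of its six vertices.
      attached-isolated : ∀ {v w} → Unique (v ∷ w ∷ C) → ∀ k → E r w (lookup C k) → ¬ E r v w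
      attached-isolated u zero wc vw =
        noP₈-select r u (# 0 ∷ # 1 ∷ # 2 ∷ # 3 ∷ # 4 ∷ # 5 ∷ # 6 ∷ # 7 ∷ []) refl
          (vw ∷ wc ∷ e₀ ∷ e₁ ∷ e₂ ∷ e₃ ∷ e₄ ∷ [-])
      attached-isolated u (suc zero) wc vw =
        noP₈-select r u (# 0 ∷ # 1 ∷ # 3 ∷ # 4 ∷ # 5 ∷ # 6 ∷ # 7 ∷ # 2 ∷ []) refl
          (vw ∷ wc ∷ e₁ ∷ e₂ ∷ e₃ ∷ e₄ ∷ e₅ ∷ [-])
      attached-isolated u (suc (suc zero)) wc vw =
        noP₈-select r u (# 0 ∷ # 1 ∷ # 4 ∷ # 5 ∷ # 6 ∷ # 7 ∷ # 2 ∷ # 3 ∷ []) refl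
          (vw ∷ wc ∷ e₂ ∷ e₃ ∷ e₄ ∷ e₅ ∷ e₀ ∷ [-])
      attached-isolated u (suc (suc (suc zero))) wc vw =
        noP₈-select r u (# 0 ∷ # 1 ∷ # 5 ∷ # 6 ∷ # 7 ∷ # 2 ∷ # 3 ∷ # 4 ∷ []) refl
          (vw ∷ wc ∷ e₃ ∷ e₄ ∷ e₅ ∷ e₀ ∷ e₁ ∷ [-])
      attached-isolated u (suc (suc (suc (suc zero)))) wc vw =
        noP₈-select r u (# 0 ∷ # 1 ∷ # 6 ∷ # 7 ∷ # 2 ∷ # 3 ∷ # 4 ∷ # 5 ∷ []) refl
          (vw ∷ wc ∷ e₄ ∷ e₅ ∷ e₀ ∷ e₁ ∷ e₂ ∷ [-])
      attached-isolated u (suc (suc (suc (suc (suc zero))))) wc vw =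
        noP₈-select r u (# 0 ∷ # 1 ∷ # 7 ∷ # 2 ∷ # 3 ∷ # 4 ∷ # 5 ∷ # 6 ∷ []) refl
          (vw ∷ wc ∷ e₅ ∷ e₀ ∷ e₁ ∷ e₂ ∷ e₃ ∷ [-])

      attached-adjacent : ∀ {v w} → Unique (v ∷ w ∷ C) → ∀ k → E r w (lookup C k) → ¬ E r v (lookup C (next k))
      attached-adjacent u zero wc vc =
        noP₈-select r u (# 0 ∷ # 3 ∷ # 4 ∷ # 5 ∷ # 6 ∷ # 7 ∷ # 2 ∷ # 1 ∷ []) refl
          (vc ∷ e₁ ∷ e₂ ∷ e₃ ∷ e₄ ∷ e₅ ∷ E-sym wc ∷ [-])
      attached-adjacent u (suc zero) wc vc =
        noP₈-select r u (# 0 ∷ # 4 ∷ # 5 ∷ # 6 ∷ # 7 ∷ # 2 ∷ # 3 ∷ # 1 ∷ []) refl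
          (vc ∷ e₂ ∷ e₃ ∷ e₄ ∷ e₅ ∷ e₀ ∷ E-sym wc ∷ [-])
      attached-adjacent u (suc (suc zero)) wc vc =
        noP₈-select r u (# 0 ∷ # 5 ∷ # 6 ∷ # 7 ∷ # 2 ∷ # 3 ∷ # 4 ∷ # 1 ∷ []) refl
          (vc ∷ e₃ ∷ e₄ ∷ e₅ ∷ e₀ ∷ e₁ ∷ E-sym wc ∷ [-])
      attached-adjacent u (suc (suc (suc zero))) wc vc =
        noP₈-select r u (# 0 ∷ # 6 ∷ # 7 ∷ # 2 ∷ # 3 ∷ # 4 ∷ # 5 ∷ # 1 ∷ []) refl
          (vc ∷ e₄ ∷ e₅ ∷ e₀ ∷ e₁ ∷ e₂ ∷ E-sym wc ∷ [-])
      attached-adjacent u (suc (suc (suc (suc zero)))) wc vc =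
        noP₈-select r u (# 0 ∷ # 7 ∷ # 2 ∷ # 3 ∷ # 4 ∷ # 5 ∷ # 6 ∷ # 1 ∷ []) refl
          (vc ∷ e₅ ∷ e₀ ∷ e₁ ∷ e₂ ∷ e₃ ∷ E-sym wc ∷ [-])
      attached-adjacent u (suc (suc (suc (suc (suc zero))))) wc vc =
        noP₈-select r u (# 0 ∷ # 2 ∷ # 3 ∷ # 4 ∷ # 5 ∷ # 6 ∷ # 7 ∷ # 1 ∷ []) refl
          (vc ∷ e₀ ∷ e₁ ∷ e₂ ∷ e₃ ∷ e₄ ∷ E-sym wc ∷ [-])

      attached-twice : ∀ {w} → Unique (w ∷ C) → ∀ k → E r w (lookup C k) → ¬ E r w (lookup C (next k))
      attached-twice u zero wc wc′ =
        noC₇ _ _ refl (Unique-select u (# 0 ∷ # 2 ∷ # 3 ∷ # 4 ∷ # 5 ∷ # 6 ∷ # 1 ∷ []))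
          (wc′ ∷ e₁ ∷ e₂ ∷ e₃ ∷ e₄ ∷ e₅ ∷ E-sym wc ∷ [-])
      attached-twice u (suc zero) wc wc′ =
        noC₇ _ _ refl (Unique-select u (# 0 ∷ # 3 ∷ # 4 ∷ # 5 ∷ # 6 ∷ # 1 ∷ # 2 ∷ []))
          (wc′ ∷ e₂ ∷ e₃ ∷ e₄ ∷ e₅ ∷ e₀ ∷ E-sym wc ∷ [-])
      attached-twice u (suc (suc zero)) wc wc′ =
        noC₇ _ _ refl (Unique-select u (# 0 ∷ # 4 ∷ # 5 ∷ # 6 ∷ # 1 ∷ # 2 ∷ # 3 ∷ []))
          (wc′ ∷ e₃ ∷ e₄ ∷ e₅ ∷ e₀ ∷ e₁ ∷ E-sym wc ∷ [-])
      attached-twice u (suc (suc (suc zero))) wc wc′ =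
        noC₇ _ _ refl (Unique-select u (# 0 ∷ # 5 ∷ # 6 ∷ # 1 ∷ # 2 ∷ # 3 ∷ # 4 ∷ []))
          (wc′ ∷ e₄ ∷ e₅ ∷ e₀ ∷ e₁ ∷ e₂ ∷ E-sym wc ∷ [-])
      attached-twice u (suc (suc (suc (suc zero)))) wc wc′ =
        noC₇ _ _ refl (Unique-select u (# 0 ∷ # 6 ∷ # 1 ∷ # 2 ∷ # 3 ∷ # 4 ∷ # 5 ∷ []))
          (wc′ ∷ e₅ ∷ e₀ ∷ e₁ ∷ e₂ ∷ e₃ ∷ E-sym wc ∷ [-])
      attached-twice u (suc (suc (suc (suc (suc zero))))) wc wc′ =
        noC₇ _ _ refl (Unique-select u (# 0 ∷ # 1 ∷ # 2 ∷ # 3 ∷ # 4 ∷ # 5 ∷ # 6 ∷ []))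
          (wc′ ∷ e₀ ∷ e₁ ∷ e₂ ∷ e₃ ∷ e₄ ∷ E-sym wc ∷ [-])

      module _ {ys : List V} (p : allFin 14 ↭ C ++ ys) where

        private
          attached? : ∀ w → Dec (Any (E r w) C)
          attached? w = any? (E? r w) C

          W Z : List V
          W = filter attached? ys
          Z = filter (¬? ∘ attached?) ys

          W⁻ : ∀ {w} → w ∈ W → w ∈ ys × ∃ λ k → E r w (lookup C k)
          W⁻ w∈ with w∈ys , att ← ∈-filter⁻ attached? {xs = ys} w∈ = w∈ys , index att , lookup-index att

          Z⁻ : ∀ {z} → z ∈ Z → z ∈ ys × ¬ Any (E r z) C
          Z⁻ = ∈-filter⁻ (¬? ∘ attached?) {xs = ys}

          all : allFin 14 ↭ C ++ W ++ Z
          all = ↭-trans p (++⁺ˡ C (filter-¬-↭ attached? ys))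

          ∉C : ∀ {v} → v ∈ ys → v ∉ C
          ∉C v∈ v∈C = Unique-++⇒Disjoint C (complement-! p) (v∈C , v∈)

          CWZ! : Unique ((C ++ W) ++ Z)
          CWZ! = complement-! (↭-trans all (↭-reflexive (sym (++-assoc C W Z))))

          outside : ∀ {v w} → v ∈ ys → w ∈ ys → v ≢ w → Unique (v ∷ w ∷ C)
          outside v∈ w∈ v≢w = ∷-Unique (λ { (here v≡w) → v≢w v≡w ; (there v∈C) → ∉C v∈ v∈C }) (∷-Unique (∉C w∈) c!)

          W-isolated : ∀ {w v} → w ∈ W → v ∈ ys → v ≢ w → ¬ E r v w
          W-isolated w∈ v∈ v≢w with w∈ys , k , wc ← W⁻ w∈ = attached-isolated (outside v∈ w∈ys v≢w) k wc

          C-Z : NoRed (C ++ W) Z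
          C-Z {x} {z} x∈ z∈ xz with ∈-++⁻ C x∈
          ... | inj₁ x∈C = proj₂ (Z⁻ z∈) (lose x∈C (E-sym xz))
          ... | inj₂ x∈W = W-isolated x∈W (proj₁ (Z⁻ z∈)) z≢x (E-sym xz)
            where
            z≢x : z ≢ x
            z≢x refl = Unique-++⇒Disjoint (C ++ W) CWZ! (x∈ , z∈)

          attachedTo : Fin 6 → Set
          attachedTo k = Any (λ w → E r w (lookup C k)) W

          attachedTo? : ∀ k → Dec (attachedTo k)
          attachedTo? k = any? (λ w → E? r w (lookup C k)) W

          -- Take outside neighbours of two consecutive cycle vertices. If they differ, the long way
          -- around the cycle joins them to a P₈; if they coincide, it closes to a C₇.
          independent : ∀ k → ¬ (attachedTo k × attachedTo (next k))
          independent k (att , att′)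
            with w , w∈ , wc ← find att | v , v∈ , vc ← find att′
            with v Fin.≟ w
          ... | yes refl = attached-twice (∷-Unique (∉C (proj₁ (W⁻ w∈))) c!) k wc vc
          ... | no v≢w = attached-adjacent (outside (proj₁ (W⁻ v∈)) (proj₁ (W⁻ w∈)) v≢w) k wc vc

          -- Three cycle vertices without red neighbours off the cycle become `Q` and the other
          -- three `S`, so every red edge leaving the cycle meets `S`.
          cover : ∀ is qs → {True (unique? (is ++ qs))} → length is ≡ 3 → length qs ≡ 3 →
                  (∀ {k} → k ∈ qs → ¬ attachedTo k) → length Z ≤ 5 → Covered r
          cover is qs {iqs!} li lq free Z≤5 = record
            { S = map (lookup C) is
            ; Q = map (lookup C) qs
            ; Z = Z
            ; W = W
            ; vertices = ↭-trans all (++⁺ C↭ (++-comm W Z))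
            ; S-length = trans (length-map (lookup C) is) li
            ; Q-length = trans (length-map (lookup C) qs) lq
            ; Z-length = Z≤5
            ; Z-closed = λ {z} {v} z∈ v∉ zv → C-Z (split v v∉) z∈ (E-sym zv)
            ; Q-W = λ q∈ w∈ qw → case ∈-map⁻ (lookup C) q∈ of λ { (k , k∈ , refl) → free k∈ (lose w∈ (E-sym qw)) }
            ; W-W = λ v∈ w∈ v≢w → W-isolated w∈ (proj₁ (W⁻ v∈)) v≢w
            }
            where
            C↭ : C ↭ map (lookup C) is ++ map (lookup C) qs
            C↭ = subst (C ↭_) (map-++ (lookup C) is qs) (Unique-⊆-length≥⇒↭ (Unique-select c! (is ++ qs) {iqs!})
              (λ v∈ → case ∈-map⁻ (lookup C) v∈ of λ { (k , _ , refl) → ∈-lookup k })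
              (ℕ.≤-reflexive (sym (trans (length-map (lookup C) (is ++ qs)) (trans (length-++ is) (cong₂ _+_ li lq))))))
            split : ∀ v → v ∉ Z → v ∈ C ++ W
            split v v∉ with ∈-++⁻ C (∈-resp-↭ all (∈-allFin v))
            ... | inj₁ v∈C = ∈-++⁺ˡ v∈C
            ... | inj₂ v∈ with ∈-++⁻ W v∈
            ...   | inj₁ v∈W = ∈-++⁺ʳ C v∈W
            ...   | inj₂ v∈Z = ⊥-elim (v∉ v∈Z)

          free : ∀ {k l m} → ¬ attachedTo k → ¬ attachedTo l → ¬ attachedTo m →
                 ∀ {j} → j ∈ k ∷ l ∷ m ∷ [] → ¬ attachedTo j
          free ¬k ¬l ¬m (here refl)                 = ¬k
          free ¬k ¬l ¬m (there (here refl))         = ¬l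
          free ¬k ¬l ¬m (there (there (here refl))) = ¬m

          covered : length Z ≤ 5 → Covered r
          covered Z≤5 with independentTriple (attachedTo? (# 0)) (attachedTo? (# 1)) (attachedTo? (# 2))
                             (attachedTo? (# 3)) (attachedTo? (# 4)) (attachedTo? (# 5))
                             (independent (# 0)) (independent (# 1)) (independent (# 2))
                             (independent (# 3)) (independent (# 4)) (independent (# 5))
          ... | inj₁ (¬k , ¬l , ¬m) = cover (# 1 ∷ # 3 ∷ # 5 ∷ []) (# 0 ∷ # 2 ∷ # 4 ∷ []) refl refl (free ¬k ¬l ¬m) Z≤5
          ... | inj₂ (inj₁ (¬k , ¬l , ¬m)) = cover (# 0 ∷ # 2 ∷ # 4 ∷ []) (# 1 ∷ # 3 ∷ # 5 ∷ []) refl refl (free ¬k ¬l ¬m) Z≤5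
          ... | inj₂ (inj₂ (inj₁ (¬k , ¬l , ¬m))) = cover (# 0 ∷ # 3 ∷ # 5 ∷ []) (# 1 ∷ # 2 ∷ # 4 ∷ []) refl refl (free ¬k ¬l ¬m) Z≤5
          ... | inj₂ (inj₂ (inj₂ (inj₁ (¬k , ¬l , ¬m)))) = cover (# 0 ∷ # 2 ∷ # 5 ∷ []) (# 1 ∷ # 3 ∷ # 4 ∷ []) refl refl (free ¬k ¬l ¬m) Z≤5
          ... | inj₂ (inj₂ (inj₂ (inj₂ (¬k , ¬l , ¬m)))) = cover (# 1 ∷ # 4 ∷ # 5 ∷ []) (# 0 ∷ # 2 ∷ # 3 ∷ []) refl refl (free ¬k ¬l ¬m) Z≤5

          Z+W≡8 : length Z + length W ≡ 8
          Z+W≡8 = ℕ.+-cancelˡ-≡ 6 _ 8 (trans (cong (6 +_) (ℕ.+-comm (length Z) (length W)))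
            (trans (cong (6 +_) (sym (length-++ W))) (complement-length C all)))

        coveredByCycle : Covered r
        coveredByCycle with sizesUpTo5 (length Z) (length W) Z+W≡8
        ... | inj₁ Z≤5 = covered Z≤5
        ... | inj₂ (inj₁ (z , w)) = ⊥-elim (noBipartite₆₈ {Z} {C ++ W} (Unique-resp-↭ (++-comm (C ++ W) Z) CWZ!)
            z (cong (6 +_) w) (λ z∈ x∈ zx → C-Z x∈ z∈ (E-sym zx)))
        ... | inj₂ (inj₂ (inj₁ (z , w))) = ⊥-elim (noBipartite₇₇ CWZ! (cong (6 +_) w) z C-Z)
        ... | inj₂ (inj₂ (inj₂ (z , w))) = ⊥-elim (noBipartite₆₈ CWZ! (cong (6 +_) w) z C-Z)

    noC₆ : ¬ Covered r → NoCycle r 6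
    noC₆ ¬covered c₀ (c₁ ∷ c₂ ∷ c₃ ∷ c₄ ∷ c₅ ∷ []) refl c! (e₀ ∷ e₁ ∷ e₂ ∷ e₃ ∷ e₄ ∷ e₅ ∷ [-])
      with ys , p ← complement c! = ¬covered (coveredByCycle c! e₀ e₁ e₂ e₃ e₄ e₅ p)

  -- Two covered colours.

  module CoveredKinds {r : Fin 3} (cov : Covered r) where

    open Covered cov

    -- Vertices of S have kind 2, too, and have to be excluded separately.
    kind : V → Fin 3
    kind v = if does (v ∈? Q) then # 0 else if does (v ∈? Z) then # 1 else # 2

    kind-Q : ∀ {v} → kind v ≡ # 0 → v ∈ Q
    kind-Q {v} eq with v ∈? Q | v ∈? Z
    kind-Q _  | yes v∈Q | _     = v∈Q
    kind-Q () | no _    | yes _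
    kind-Q () | no _    | no _

    kind-Z : ∀ {v} → kind v ≡ # 1 → v ∈ Z
    kind-Z {v} eq with v ∈? Q | v ∈? Z
    kind-Z () | yes _ | _
    kind-Z _  | no _  | yes v∈Z = v∈Z
    kind-Z () | no _  | no _

    vertices-! : Unique ((S ++ Q) ++ (Z ++ W))
    vertices-! = Unique-resp-↭ vertices (allFin⁺ 14)

    remaining : ∀ {v} → v ∉ S → v ∉ Q → v ∉ Z → v ∈ W
    remaining {v} v∉S v∉Q v∉Z with ∈-++⁻ (S ++ Q) (∈-resp-↭ vertices (∈-allFin v))
    ... | inj₁ v∈ = ⊥-elim ([ v∉S , v∉Q ]′ (∈-++⁻ S v∈))
    ... | inj₂ v∈ = [ (λ v∈Z → ⊥-elim (v∉Z v∈Z)) , (λ v∈W → v∈W) ]′ (∈-++⁻ Z v∈)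

    -- Outside `S`, kind 2 means `W`. As `W` is independent, `differ` holds for two vertices of kind
    -- 2 as well, and `x ≢ y` takes care of that case.
    apart : ∀ {x y} → x ∉ S → y ∉ S → x ≢ y → T (differ (kind x) (kind y)) → ¬ E r x y
    apart {x} {y} x∉S y∉S x≢y d xy with x ∈? Q | x ∈? Z | y ∈? Q | y ∈? Z
    ... | yes x∈Q | _       | no y∉Q  | yes y∈Z =
      Z-closed y∈Z (λ x∈Z → Unique-++⇒Disjoint (S ++ Q) vertices-! (∈-++⁺ʳ S x∈Q , ∈-++⁺ˡ x∈Z)) (E-sym xy)
    ... | yes x∈Q | _       | no y∉Q  | no y∉Z  = Q-W x∈Q (remaining y∉S y∉Q y∉Z) xy
    ... | no x∉Q  | yes x∈Z | yes y∈Q | _       =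
      Z-closed x∈Z (λ y∈Z → Unique-++⇒Disjoint (S ++ Q) vertices-! (∈-++⁺ʳ S y∈Q , ∈-++⁺ˡ y∈Z)) xy
    ... | no x∉Q  | yes x∈Z | no y∉Q  | no y∉Z  = Z-closed x∈Z y∉Z xy
    ... | no x∉Q  | no x∉Z  | yes y∈Q | _       = Q-W y∈Q (remaining x∉S x∉Q x∉Z) (E-sym xy)
    ... | no x∉Q  | no x∉Z  | no y∉Q  | yes y∈Z = Z-closed y∈Z x∉Z (E-sym xy)
    ... | no x∉Q  | no x∉Z  | no y∉Q  | no y∉Z  =
      W-W (remaining x∉S x∉Q x∉Z) (remaining y∉S y∉Q y∉Z) x≢y xy

  module KindCounts {n m : ℕ} (P : Pairing n m) (ok : Fin n → Fin n → Bool) (k₁ : V → Fin n) (k₂ : V → Fin 3)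
    {ws : List V} (ws! : Unique ws) (g : Fin 3)
    (g-edge : ∀ {x y} → x ∈ ws → y ∈ ws → x ≢ y →
              T (ok (k₁ x) (k₁ y)) → T (differ (k₂ x) (k₂ y)) → E g x y)
    where

    open Pairing P

    label : V → Fin m
    label v = pair (k₁ v) (k₂ v)

    open Classes label ws public

    Class : Fin m → V → Set
    Class k v = v ∈ ws × label v ≡ k

    sound : ∀ {k l x y} → T (compatible ok k l) → Class k x → Class l y → x ≢ y → E g x y
    sound {x = x} {y} t (x∈ , refl) (y∈ , refl) x≢y with ok-t , differ-t ← Equivalence.to T-∧ t =
      g-edge x∈ y∈ x≢y
        (subst₂ (λ i j → T (ok i j)) (fst-pair (k₁ x) (k₂ x)) (fst-pair (k₁ y) (k₂ y)) ok-t)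
        (subst₂ (λ i j → T (differ i j)) (snd-pair (k₁ x) (k₂ x)) (snd-pair (k₁ y) (k₂ y)) differ-t)

    -- A class may be compatible with itself, so an edge is promised for distinct vertices only;
    -- `edge-path` obtains their distinctness from `Unique`.
    open WalkSoundness (compatible ok) Class (λ x y → x ≢ y → E g x y) sound

    noWalk : ¬ T (Walks.walkSomewhere (compatible ok) 7 sizes)
    noWalk t = absurd (walkSomewhere-sound 7 sizes t classes sizes-fit (λ k → ∈-classes⁻ k) (join-classes-! ws!))
      where
      edge-path : ∀ {p} → Unique p → Linked (λ x y → x ≢ y → E g x y) p → Linked (E g) p
      edge-path _ [] = []
      edge-path _ [-] = [-]
      edge-path ((x≢y ∷ _) ∷ u) (e ∷ link) = e x≢y ∷ edge-path u link
      absurd : (∃ λ p → length p ≡ 8 × Linked (λ x y → x ≢ y → E g x y) p × Unique p × p ⊆ join classes) → ⊥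
      absurd (p , len , link , p! , _) = noP₈ g p p! (edge-path p! link) len

    atMost : ∀ (f : Fin m → Bool) {zs} → (∀ {x} → x ∈ ws → T (f (label x)) → x ∈ zs) → total f sizes ≤ length zs
    atMost f {zs} sub = subst (_≤ length zs) (sym (total-sizes ws! f))
      (Unique-⊆⇒length≤ (Unique.filter⁺ (λ x → T? (f (label x))) ws!) λ x∈ →
        let x∈ws , t = ∈-filter⁻ (λ x → T? (f (label x))) {xs = ws} x∈ in sub x∈ws t)

    atLeast : ∀ (f : Fin m → Bool) {zs} → Unique zs → zs ⊆ ws → (∀ {x} → x ∈ zs → T (f (label x))) → length zs ≤ total f sizes
    atLeast f {zs} zs! zs⊆ all = subst (length zs ≤_) (sym (total-sizes ws! f))
      (Unique-⊆⇒length≤ zs! λ x∈ → ∈-filter⁺ (λ x → T? (f (label x))) (zs⊆ x∈) (all x∈))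

    ofKind≤ : ∀ i {zs} → (∀ {x} → x ∈ ws → k₁ x ≡ i → x ∈ zs) → ofKind i sizes ≤ length zs
    ofKind≤ i sub = atMost (λ k → fst k == i) λ {x} x∈ t →
      sub x∈ (trans (sym (fst-pair (k₁ x) (k₂ x))) (==⇒≡ t))

    ofKind′≤ : ∀ j {zs} → (∀ {x} → x ∈ ws → k₂ x ≡ j → x ∈ zs) → ofKind′ j sizes ≤ length zs
    ofKind′≤ j sub = atMost (λ k → snd k == j) λ {x} x∈ t →
      sub x∈ (trans (sym (snd-pair (k₁ x) (k₂ x))) (==⇒≡ t))

    ≤ofKind : ∀ i {zs} → Unique zs → zs ⊆ ws → (∀ {x} → x ∈ zs → k₁ x ≡ i) → length zs ≤ ofKind i sizes
    ≤ofKind i zs! zs⊆ all = atLeast (λ k → fst k == i) zs! zs⊆ λ {x} x∈ →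
      ≡⇒== (trans (fst-pair (k₁ x) (k₂ x)) (all x∈))

  module TwoCovered {r b g : Fin 3} (colours : ∀ i → i ≡ r ⊎ i ≡ b ⊎ i ≡ g)
    (red : Covered r) (blue : Covered b) where

    private
      module R = Covered red
      module B = Covered blue
      module RK = CoveredKinds red
      module BK = CoveredKinds blue

    green : ∀ {x y} → ¬ E r x y → ¬ E b x y → E g x y
    green {x} {y} ¬r ¬b with colours (col x y)
    ... | inj₁ e        = ⊥-elim (¬r e)
    ... | inj₂ (inj₁ e) = ⊥-elim (¬b e)
    ... | inj₂ (inj₂ e) = e

    Z∖S : List V
    Z∖S = filter (λ v → ¬? (v ∈? B.S)) R.Z

    Z∖S⁻ : ∀ {v} → v ∈ Z∖S → v ∈ R.Z × v ∉ B.S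
    Z∖S⁻ = ∈-filter⁻ (λ v → ¬? (v ∈? B.S)) {xs = R.Z}

    -- Otherwise there is a green P₈ between Z∖S and the vertices outside Z and S.
    length-Z∖S : length Z∖S ≤ 3
    length-Z∖S = ℕ.≮⇒≥ absurd
      where
      others rows columns ws : List V
      others  = filter (λ v → ¬? (v ∈? (R.Z ++ B.S))) (allFin 14)
      rows    = take 4 Z∖S
      columns = take 6 others
      ws      = rows ++ columns
      side : V → Fin 2
      side v = if does (v ∈? R.Z) then # 0 else # 1
      others⁻ : ∀ {v} → v ∈ others → v ∉ R.Z ++ B.S
      others⁻ v∈ = proj₂ (∈-filter⁻ (λ v → ¬? (v ∈? (R.Z ++ B.S))) {xs = allFin 14} v∈)
      -- Of 14 vertices, at most 5 lie in the red `Z` and 3 in the blue `S`.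
      others-length : 6 ≤ length others
      others-length = ℕ.+-cancelˡ-≤ 8 6 (length others) (ℕ.≤-trans
        (covering⇒≤length {xs = (R.Z ++ B.S) ++ others} cover)
        (ℕ.≤-trans (ℕ.≤-reflexive (trans (length-++ (R.Z ++ B.S)) (cong (_+ length others) (length-++ R.Z))))
          (ℕ.+-monoˡ-≤ (length others) (ℕ.+-mono-≤ R.Z-length (ℕ.≤-reflexive B.S-length)))))
        where
        cover : ∀ v → v ∈ (R.Z ++ B.S) ++ others
        cover v with v ∈? (R.Z ++ B.S)
        ... | yes v∈ = ∈-++⁺ˡ v∈
        ... | no v∉  = ∈-++⁺ʳ (R.Z ++ B.S) (∈-filter⁺ (λ v → ¬? (v ∈? (R.Z ++ B.S))) (∈-allFin v) v∉)
      row : ∀ {v} → v ∈ rows → v ∈ R.Z × v ∉ B.S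
      row v∈ = Z∖S⁻ (take-⊆ 4 Z∖S v∈)
      column : ∀ {v} → v ∈ columns → v ∉ R.Z × v ∉ B.S
      column v∈ = (λ v∈Z → others⁻ (take-⊆ 6 others v∈) (∈-++⁺ˡ v∈Z))
                , (λ v∈S → others⁻ (take-⊆ 6 others v∈) (∈-++⁺ʳ R.Z v∈S))
      vertex : ∀ {v} → v ∈ ws → v ∉ B.S
      vertex v∈ = [ (λ v∈r → proj₂ (row v∈r)) , (λ v∈c → proj₂ (column v∈c)) ]′ (∈-++⁻ rows v∈)
      Z! : Unique R.Z
      Z! = Unique-++⁻ˡ R.Z (Unique-++⁻ʳ (R.S ++ R.Q) RK.vertices-!)
      rows! : Unique rows
      rows! = Unique.take⁺ 4 (Unique.filter⁺ (λ v → ¬? (v ∈? B.S)) Z!)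
      ws! : Unique ws
      ws! = Unique.++⁺ rows! (Unique.take⁺ 6 (Unique.filter⁺ (λ v → ¬? (v ∈? (R.Z ++ B.S))) (allFin⁺ 14)))
        λ { (v∈r , v∈c) → proj₁ (column v∈c) (proj₁ (row v∈r)) }
      across : ∀ {x y} → T (acrossSides (side x) (side y)) → x ≢ y → ¬ E r x y
      across {x} {y} t _ xy with x ∈? R.Z | y ∈? R.Z
      ... | yes x∈Z | no y∉Z  = R.Z-closed x∈Z y∉Z xy
      ... | no x∉Z  | yes y∈Z = R.Z-closed y∈Z x∉Z (E-sym xy)
      g-edge : ∀ {x y} → x ∈ ws → y ∈ ws → x ≢ y →
               T (acrossSides (side x) (side y)) → T (differ (BK.kind x) (BK.kind y)) → E g x y
      g-edge {x} {y} x∈ y∈ x≢y t d =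
        green (across {x} {y} t x≢y) (BK.apart (vertex x∈) (vertex y∈) x≢y d)
      side-row : ∀ {v} → v ∈ rows → side v ≡ # 0
      side-row {v} v∈ with v ∈? R.Z
      ... | yes _  = refl
      ... | no v∉Z = ⊥-elim (v∉Z (proj₁ (row v∈)))
      row-side : ∀ {v} → v ∈ ws → side v ≡ # 0 → v ∈ rows
      row-side {v} v∈ eq with v ∈? R.Z
      row-side {v} v∈ refl | yes v∈Z =
        [ (λ v∈r → v∈r) , (λ v∈c → ⊥-elim (proj₁ (column v∈c) v∈Z)) ]′ (∈-++⁻ rows v∈)
      row-side v∈ () | no _
      module KC = KindCounts pairing₂ acrossSides side BK.kind ws! g g-edge
      absurd : ¬ 4 ≤ length Z∖S
      absurd 4≤ = KC.noWalk (FourBySix.has-P₈ KC.sizes (trans (KC.sum-sizes ws!) ws-length)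
        (subst (_≤ Pairing.ofKind pairing₂ (# 0) KC.sizes) rows-length (KC.≤ofKind (# 0) rows! ∈-++⁺ˡ side-row))
        (subst (Pairing.ofKind pairing₂ (# 0) KC.sizes ≤_) rows-length (KC.ofKind≤ (# 0) row-side))
        (ℕ.≤-trans (KC.ofKind′≤ (# 0) (λ _ → BK.kind-Q)) (ℕ.≤-reflexive B.Q-length))
        (ℕ.≤-trans (KC.ofKind′≤ (# 1) (λ _ → BK.kind-Z)) B.Z-length))
        where
        rows-length : length rows ≡ 4
        rows-length = length-take-≤ {n = 4} {Z∖S} 4≤
        ws-length : length ws ≡ 10
        ws-length = trans (length-++ rows) (cong₂ _+_ rows-length (length-take-≤ {n = 6} {others} others-length))

  module NotBothCovered {r b g : Fin 3} (colours : ∀ i → i ≡ r ⊎ i ≡ b ⊎ i ≡ g)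
    (red : Covered r) (blue : Covered b) where

    private
      module R = Covered red
      module B = Covered blue
      module RK = CoveredKinds red
      module BK = CoveredKinds blue
      module RB = TwoCovered colours red blue
      colours′ : ∀ i → i ≡ b ⊎ i ≡ r ⊎ i ≡ g
      colours′ i = [ (λ e → inj₂ (inj₁ e)) , [ inj₁ , (λ e → inj₂ (inj₂ e)) ]′ ]′ (colours i)
      module BR = TwoCovered colours′ blue red

      others ws : List V
      others = filter (λ v → ¬? (v ∈? (R.S ++ B.S))) (allFin 14)
      ws     = take 8 others

      -- Of 14 vertices, at most 3 + 3 lie in the two sets `S`.
      others-length : 8 ≤ length others
      others-length = ℕ.+-cancelˡ-≤ 6 8 (length others) (ℕ.≤-trans
        (covering⇒≤length {xs = (R.S ++ B.S) ++ others} cover)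
        (ℕ.≤-reflexive (trans (length-++ (R.S ++ B.S)) (cong (_+ length others)
          (trans (length-++ R.S) (cong₂ _+_ R.S-length B.S-length))))))
        where
        cover : ∀ v → v ∈ (R.S ++ B.S) ++ others
        cover v with v ∈? (R.S ++ B.S)
        ... | yes v∈ = ∈-++⁺ˡ v∈
        ... | no v∉  = ∈-++⁺ʳ (R.S ++ B.S) (∈-filter⁺ (λ v → ¬? (v ∈? (R.S ++ B.S))) (∈-allFin v) v∉)

      ws⁻ : ∀ {v} → v ∈ ws → v ∉ R.S × v ∉ B.S
      ws⁻ v∈ = let v∉ = proj₂ (∈-filter⁻ (λ v → ¬? (v ∈? (R.S ++ B.S))) {xs = allFin 14} (take-⊆ 8 others v∈)) in
        (λ v∈S → v∉ (∈-++⁺ˡ v∈S)) , (λ v∈S → v∉ (∈-++⁺ʳ R.S v∈S))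

      ws! : Unique ws
      ws! = Unique.take⁺ 8 (Unique.filter⁺ (λ v → ¬? (v ∈? (R.S ++ B.S))) (allFin⁺ 14))

      g-edge : ∀ {x y} → x ∈ ws → y ∈ ws → x ≢ y →
               T (differ (RK.kind x) (RK.kind y)) → T (differ (BK.kind x) (BK.kind y)) → E g x y
      g-edge x∈ y∈ x≢y d d′ = RB.green
        (RK.apart (proj₁ (ws⁻ x∈)) (proj₁ (ws⁻ y∈)) x≢y d) (BK.apart (proj₂ (ws⁻ x∈)) (proj₂ (ws⁻ y∈)) x≢y d′)

      module KC = KindCounts pairing₃ differ RK.kind BK.kind ws! g g-edge

    impossible : ⊥
    impossible = KC.noWalk (EightVertices.hamiltonian KC.sizes
      (trans (KC.sum-sizes ws!) (length-take-≤ {n = 8} {others} others-length))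
      (ℕ.≤-trans (KC.ofKind≤ (# 0) (λ _ → RK.kind-Q)) (ℕ.≤-reflexive R.Q-length))
      -- Since `ws` avoids the other colour's `S`, only `Z∖S` counts here, which lowers the bound
      -- from 5 to 3.
      (ℕ.≤-trans (KC.ofKind≤ (# 1) (λ v∈ eq → ∈-filter⁺ (λ v → ¬? (v ∈? B.S)) (RK.kind-Z eq) (proj₂ (ws⁻ v∈)))) RB.length-Z∖S)
      (ℕ.≤-trans (KC.ofKind′≤ (# 0) (λ _ → BK.kind-Q)) (ℕ.≤-reflexive B.Q-length))
      (ℕ.≤-trans (KC.ofKind′≤ (# 1) (λ v∈ eq → ∈-filter⁺ (λ v → ¬? (v ∈? R.S)) (BK.kind-Z eq) (proj₁ (ws⁻ v∈)))) BR.length-Z∖S))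

  -- One covered colour has too few edges.

  module OneCovered {r b g : Fin 3} (colours : ∀ i → i ≡ r ⊎ i ≡ b ⊎ i ≡ g) (red : Covered r) where

    open Covered red
    open CoveredKinds red using (vertices-!)

    private
      colours-rgb : ∀ i → i ≡ r ⊎ i ≡ g ⊎ i ≡ b
      colours-rgb i = [ inj₁ , [ (λ e → inj₂ (inj₂ e)) , (λ e → inj₂ (inj₁ e)) ]′ ]′ (colours i)

      colours-b : ∀ i → i ≡ b ⊎ i ≡ r ⊎ i ≡ g
      colours-b i = [ (λ e → inj₂ (inj₁ e)) , [ inj₁ , (λ e → inj₂ (inj₂ e)) ]′ ]′ (colours i)

      colours-g : ∀ i → i ≡ g ⊎ i ≡ r ⊎ i ≡ b
      colours-g i = [ (λ e → inj₂ (inj₁ e)) , [ (λ e → inj₂ (inj₂ e)) , inj₁ ]′ ]′ (colours i)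

      -- A C₆ in blue or green would make that colour covered, too. So both obey the bound 2n, and
      -- all other pairs have to be red.
      manyRed : ∀ L → Unique L → pairs (length L) ≤ edges r L + (2 * length L + 2 * length L)
      manyRed L L! = ℕ.≤-trans (edges-total colours L) (ℕ.+-monoʳ-≤ (edges r L) (ℕ.+-mono-≤
        (edges≤2length b
          (Cycles.noC₆ colours-b (NotBothCovered.impossible colours red))
          (Cycles.noC₇ colours-b) L L!)
        (edges≤2length g
          (Cycles.noC₆ colours-g (NotBothCovered.impossible colours-rgb red))
          (Cycles.noC₇ colours-g) L L!)))

      QZW! : Unique (Q ++ (Z ++ W))
      QZW! = Unique-++⁻ʳ S (subst Unique (++-assoc S Q (Z ++ W)) vertices-!)

      Q∩Z : ∀ {v} → v ∈ Q → v ∉ Z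
      Q∩Z v∈Q v∈Z = Unique-++⇒Disjoint Q QZW! (v∈Q , ∈-++⁺ˡ v∈Z)

      inZ : ∀ {z w} → z ∈ Z → E r z w → w ∈ Z ++ []
      inZ {z} {w} z∈ zw with w ∈? Z
      ... | yes w∈ = ∈-++⁺ˡ w∈
      ... | no w∉  = ⊥-elim (Z-closed z∈ w∉ zw)

      -- Outside S there are at most 3 + 6 red edges, but 55 − 44 are needed.
      small : ¬ length Z ≤ 4
      small Z≤4 = ℕ.<⇒≱ {53} {55} (ℕ.≤ᵇ⇒≤ 54 55 tt) (begin
        55                                   ≡⟨ cong pairs (sym len) ⟩
        pairs (length L)                     ≤⟨ manyRed L QZW! ⟩
        edges r L + (2 * length L + 2 * length L)
                                             ≡⟨ cong (λ n → edges r L + (2 * n + 2 * n)) len ⟩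
        edges r L + 44                       ≤⟨ ℕ.+-monoˡ-≤ 44 red≤9 ⟩
        53                                   ∎)
        where
        open ℕ.≤-Reasoning
        L : List V
        L = Q ++ (Z ++ W)
        len : length L ≡ 11
        len = ℕ.+-cancelˡ-≡ 3 (length L) 11 (trans (cong (_+ length L) (sym S-length))
          (trans (sym (length-++ S)) (trans (cong length (sym (++-assoc S Q (Z ++ W)))) (sym (↭-length vertices)))))
        bound : ∀ z → z ≤ 4 → closedBound z 0 ≤ 6
        bound 0 _ = z≤n
        bound 1 _ = z≤n
        bound 2 _ = ℕ.≤ᵇ⇒≤ 1 6 tt
        bound 3 _ = ℕ.≤ᵇ⇒≤ 3 6 tt
        bound 4 _ = ℕ.≤-refl
        bound (suc (suc (suc (suc (suc z))))) (s≤s (s≤s (s≤s (s≤s ()))))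
        Q-closed : ∀ {q w} → q ∈ Q → w ∈ Q ++ (Z ++ W) → E r q w → w ∈ Q ++ []
        Q-closed q∈ w∈ qw with ∈-++⁻ Q w∈
        ... | inj₁ w∈Q = ∈-++⁺ˡ w∈Q
        ... | inj₂ w∈ZW with ∈-++⁻ Z w∈ZW
        ...   | inj₁ w∈Z = ⊥-elim (Z-closed w∈Z (Q∩Z q∈) (E-sym qw))
        ...   | inj₂ w∈W = ⊥-elim (Q-W q∈ w∈W qw)
        edges-W : edges r W ≤ 0
        edges-W = begin
          edges r W              ≡⟨ cong (edges r) (sym (++-identityʳ W)) ⟩
          edges r (W ++ [])      ≤⟨ edges-independent r W [] (subst Unique (sym (++-identityʳ W)) W!) W-empty ⟩
          length W * 0 + 0       ≡⟨ trans (ℕ.+-identityʳ _) (ℕ.*-zeroʳ (length W)) ⟩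
          0                      ∎
          where
          W! : Unique W
          W! = Unique-++⁻ʳ Z (Unique-++⁻ʳ Q QZW!)
          W-empty : ∀ {w v} → w ∈ W → v ∈ W ++ [] → w ≢ v → E r w v → v ∈ []
          W-empty w∈ v∈ w≢v wv = ⊥-elim (W-W w∈ (subst (_ ∈_) (++-identityʳ W) v∈) w≢v wv)
        red≤9 : edges r L ≤ 9
        red≤9 = begin
          edges r L
            ≤⟨ edges-closed r Q [] QZW! Q-closed ⟩
          closedBound (length Q) 0 + edges r (Z ++ W)
            ≤⟨ ℕ.+-mono-≤ (ℕ.≤-reflexive (cong (λ n → closedBound n 0) Q-length))
                 (edges-closed r Z [] (Unique-++⁻ʳ Q QZW!) λ z∈ _ → inZ z∈) ⟩
          3 + (closedBound (length Z) 0 + edges r W)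
            ≤⟨ ℕ.+-monoʳ-≤ 3 (ℕ.+-mono-≤ (bound (length Z) Z≤4) edges-W) ⟩
          9 ∎

      -- There are at most 10 + 12 + 9 + 3 red edges, but 91 − 56 are needed.
      large : length Z ≢ 5
      large Z≡5 = ℕ.<⇒≱ {90} {91} (ℕ.≤-refl) (begin
        91                                   ≡⟨ cong pairs (sym len) ⟩
        pairs (length L)                     ≤⟨ manyRed L L! ⟩
        edges r L + (2 * length L + 2 * length L)
                                             ≡⟨ cong (λ n → edges r L + (2 * n + 2 * n)) len ⟩
        edges r L + 56                       ≤⟨ ℕ.+-monoˡ-≤ 56 red≤34 ⟩
        90                                   ∎)
        where
        open ℕ.≤-Reasoning
        L : List V
        L = Z ++ (Q ++ (W ++ S))
        reorder : (S ++ Q) ++ (Z ++ W) ↭ L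
        reorder = ↭-trans (++-comm (S ++ Q) (Z ++ W)) (↭-trans (↭-reflexive (++-assoc Z W (S ++ Q)))
          (++⁺ˡ Z (↭-trans (↭-reflexive (sym (++-assoc W S Q))) (++-comm (W ++ S) Q))))
        L! : Unique L
        L! = Unique-resp-↭ reorder vertices-!
        len : length L ≡ 14
        len = sym (↭-length (↭-trans vertices reorder))
        W-length : length W ≡ 3
        W-length = ℕ.+-cancelˡ-≡ 11 (length W) 3 (trans (cong₂ (λ m n → m + (n + length W))
            (sym (trans (length-++ S) (cong₂ _+_ S-length Q-length))) (sym Z≡5))
          (trans (cong (length (S ++ Q) +_) (sym (length-++ Z)))
            (trans (sym (length-++ (S ++ Q))) (sym (↭-length vertices)))))
        Q-closed : ∀ {q w} → q ∈ Q → w ∈ Q ++ (W ++ S) → E r q w → w ∈ Q ++ S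
        Q-closed q∈ w∈ qw with ∈-++⁻ Q w∈
        ... | inj₁ w∈Q = ∈-++⁺ˡ w∈Q
        ... | inj₂ w∈WS with ∈-++⁻ W w∈WS
        ...   | inj₁ w∈W = ⊥-elim (Q-W q∈ w∈W qw)
        ...   | inj₂ w∈S = ∈-++⁺ʳ Q w∈S
        W-closed : ∀ {w v} → w ∈ W → v ∈ W ++ S → w ≢ v → E r w v → v ∈ S
        W-closed w∈ v∈ w≢v wv with ∈-++⁻ W v∈
        ... | inj₁ v∈W = ⊥-elim (W-W w∈ v∈W w≢v wv)
        ... | inj₂ v∈S = v∈S
        QWS! : Unique (Q ++ (W ++ S))
        QWS! = Unique-++⁻ʳ Z L!
        WS! : Unique (W ++ S)
        WS! = Unique-++⁻ʳ Q QWS!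
        S! : Unique (S ++ [])
        S! = subst Unique (sym (++-identityʳ S)) (Unique-++⁻ʳ W WS!)
        -- The terms are 10 inside `Z`, 3 + 9 inside `Q` and from `Q` to `S`, 9 from `W` to `S`, and
        -- 3 inside `S`.
        red≤34 : edges r L ≤ 34
        red≤34 = begin
          edges r L
            ≤⟨ edges-closed r Z [] L! (λ z∈ _ → inZ z∈) ⟩
          closedBound (length Z) 0 + edges r (Q ++ (W ++ S))
            ≤⟨ ℕ.+-mono-≤ (ℕ.≤-reflexive (cong (λ n → closedBound n 0) Z≡5)) (edges-closed r Q S QWS! Q-closed) ⟩
          10 + (closedBound (length Q) (length S) + edges r (W ++ S))
            ≤⟨ ℕ.+-monoʳ-≤ 10 (ℕ.+-mono-≤ (ℕ.≤-reflexive (cong₂ closedBound Q-length S-length))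
                 (edges-independent r W S WS! W-closed)) ⟩
          22 + (length W * length S + edges r S)
            ≤⟨ ℕ.+-monoʳ-≤ 22 (ℕ.+-mono-≤ (ℕ.≤-reflexive (cong₂ _*_ W-length S-length))
                 (ℕ.≤-trans (ℕ.≤-reflexive (cong (edges r) (sym (++-identityʳ S)))) (edges-closed r S [] S! (λ _ w∈ _ → w∈)))) ⟩
          31 + (closedBound (length S) 0 + 0)
            ≡⟨ cong (λ n → 31 + (closedBound n 0 + 0)) S-length ⟩
          34 ∎

    -- Neither count covers both cases. A small `Z` leaves a large `W`, which may send 3 edges per
    -- vertex to `S`, so `S` has to be deleted. With five vertices in `Z`, up to 3 + 10 red edges
    -- avoid `S`, more than the 11 needed there, but `W` has only three vertices and the count on
    -- all of V succeeds.
    notCovered : ⊥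
    notCovered = [ (λ Z<5 → small (ℕ.≤-pred Z<5)) , large ]′ (ℕ.m≤n⇒m<n∨m≡n Z-length)

  others : (r : Fin 3) → ∃ λ b → ∃ λ g → ∀ i → i ≡ r ⊎ i ≡ b ⊎ i ≡ g
  others zero = # 1 , # 2 , λ where
    zero             → inj₁ refl
    (suc zero)       → inj₂ (inj₁ refl)
    (suc (suc zero)) → inj₂ (inj₂ refl)
  others (suc zero) = # 0 , # 2 , λ where
    zero             → inj₂ (inj₁ refl)
    (suc zero)       → inj₁ refl
    (suc (suc zero)) → inj₂ (inj₂ refl)
  others (suc (suc zero)) = # 0 , # 1 , λ where
    zero             → inj₂ (inj₁ refl)
    (suc zero)       → inj₂ (inj₂ refl)
    (suc (suc zero)) → inj₁ refl

  impossible : ⊥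
  impossible = ℕ.<⇒≱ {84} {91} (ℕ.≤ᵇ⇒≤ 85 91 tt)
    (ℕ.≤-trans (edges-total {# 0} (proj₂ (proj₂ (others (# 0)))) (allFin 14))
      (ℕ.+-mono-≤ (few (# 0)) (ℕ.+-mono-≤ (few (# 1)) (few (# 2)))))
    where
    few : ∀ i → edges i (allFin 14) ≤ 28
    few i with b , g , colours ← others i =
      edges≤2length i (Cycles.noC₆ colours (OneCovered.notCovered colours)) (Cycles.noC₇ colours) (allFin 14) (allFin⁺ 14)

-- The lower bound.

-- Vertices 0–2, 3–5, 6–8 and 9–12 are the parts, indexed by the pairs (top n , left n).
-- The three perfect matchings of K₄ become the colours; colour 0 is also used inside the parts.
top left : ℕ → Bool
top  n = n <ᵇ 6
left n = (n <ᵇ 3) ∨ ((5 <ᵇ n) ∧ (n <ᵇ 9))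

partColour : Bool → Bool → Fin 3
partColour false _     = # 0
partColour true  false = # 1
partColour true  true  = # 2

-- Regard the parts as the points of a plane over the field with two elements. `side i` is the
-- nonzero linear form that is constant on the pairs of the matching `i`, so its two values separate
-- the components of that colour.
side : Fin 3 → Bool → Bool → Bool
side zero             x y = x
side (suc zero)       x y = y
side (suc (suc zero)) x y = x xor y

side-invariant : ∀ x y x′ y′ {i} → partColour (x xor x′) (y xor y′) ≡ i → side i x y ≡ side i x′ y′
side-invariant false _     false _     refl = refl
side-invariant true  _     true  _     refl = refl
side-invariant false false true  false refl = refl
side-invariant false false true  true  refl = refl
side-invariant false true  true  false refl = refl
side-invariant false true  true  true  refl = refl
side-invariant true  false false false refl = refl
side-invariant true  false false true  refl = refl
side-invariant true  true  false false refl = refl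
side-invariant true  true  false true  refl = refl

sideOf : Fin 3 → ℕ → Bool
sideOf i n = side i (top n) (left n)

sideOf-fibres : ∀ i s → length (filter (λ n → sideOf i n ≟ᵇ s) (upTo 13)) ≤ 7
sideOf-fibres zero             false = ℕ.≤ᵇ⇒≤ 7 7 tt
sideOf-fibres zero             true  = ℕ.≤ᵇ⇒≤ 6 7 tt
sideOf-fibres (suc zero)       false = ℕ.≤ᵇ⇒≤ 7 7 tt
sideOf-fibres (suc zero)       true  = ℕ.≤ᵇ⇒≤ 6 7 tt
sideOf-fibres (suc (suc zero)) false = ℕ.≤ᵇ⇒≤ 7 7 tt
sideOf-fibres (suc (suc zero)) true  = ℕ.≤ᵇ⇒≤ 6 7 tt

-- The colour is read off the numbers of the vertices, so that one rule serves every M ≤ 13.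
partColouring : ∀ M → EdgeColouring (complete M) 3
partColouring M .colour {u} {v} _ =
  partColour (top (toℕ u) xor top (toℕ v)) (left (toℕ u) xor left (toℕ v))
partColouring M .colour-sym {u} {v} _ _ =
  cong₂ partColour (xor-comm (top (toℕ u)) (top (toℕ v))) (xor-comm (left (toℕ u)) (left (toℕ v)))

constant-on-path : ∀ {A : Set} {n} (f : Fin (suc n) → A) → (∀ j → f (inject₁ j) ≡ f (suc j)) →
                   ∀ j → f j ≡ f zero
constant-on-path f eq zero = refl
constant-on-path {n = suc n} f eq (suc j) =
  trans (constant-on-path (f ∘ suc) (eq ∘ suc) j) (sym (eq zero))

-- The colour classes have components with at most seven vertices.
lowerBound : ∀ {M} → M ≤ 13 → ¬ Forces 3 M (path 8)
lowerBound {M} M≤13 forces = noCopy (forces (partColouring M))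
  where
  noCopy : ¬ (∃ λ i → path 8 ⊑ colourClass (partColouring M) i)
  noCopy (i , f , f-inj , f-hom) = ℕ.<⇒≱ {7} {8} ℕ.≤-refl
    (ℕ.≤-trans (Unique-⊆⇒length≤ (Unique.tabulate⁺ (λ eq → f-inj (Fin.toℕ-injective eq))) inFibre)
      (sideOf-fibres i (s (# 0))))
    where
    s : Fin 8 → Bool
    s j = sideOf i (toℕ (f j))
    edge : ∀ {u v} → Adj (path 8) u v → s u ≡ s v
    edge {u} {v} uv = side-invariant (top (toℕ (f u))) (left (toℕ (f u))) _ _ (proj₂ (f-hom uv))
    constant : ∀ j → s j ≡ s (# 0)
    constant = constant-on-path s λ j → edge (inj₁ (cong suc (sym (Fin.toℕ-inject₁ j))))
    inFibre : tabulate (λ j → toℕ (f j)) ⊆ filter (λ n → sideOf i n ≟ᵇ s (# 0)) (upTo 13)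
    inFibre n∈ with j , refl ← ∈-tabulate⁻ {f = λ j → toℕ (f j)} n∈ =
      ∈-filter⁺ (λ n → sideOf i n ≟ᵇ s (# 0)) (∈-upTo⁺ (ℕ.<-≤-trans (Fin.toℕ<n (f j)) M≤13)) (constant j)

-- From the contradiction to a monochromatic path.

-- The argument above only refutes the absence of a P₈. Since there are finitely many sequences of
-- eight vertices, the existence of one is decidable, and the refutation yields it.
anyVec? : ∀ {n} k {P : Vec (Fin n) k → Set} → (∀ v → Dec (P v)) → Dec (∃ P)
anyVec? zero    P? = map′ ([] ,_) (λ { ([] , p) → p }) (P? [])
anyVec? (suc k) P? = map′ (λ { (x , v , p) → x ∷ v , p }) (λ { (x ∷ v , p) → x , v , p })
  (Fin.any? λ x → anyVec? k λ v → P? (x ∷ v))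

module UpperBound (c : EdgeColouring (complete 14) 3) where

  col : V → V → Fin 3
  col u v with u Fin.≟ v
  ... | yes _  = # 0
  ... | no u≢v = colour c u≢v

  col-colour : ∀ {u v} (u≢v : u ≢ v) → col u v ≡ colour c u≢v
  col-colour {u} {v} u≢v with u Fin.≟ v
  ... | yes u≡v = ⊥-elim (u≢v u≡v)
  -- Two uses of `colour-sym`, there and back, show that the colour does not depend on the proof of
  -- distinctness.
  ... | no u≢v′ = trans (colour-sym c u≢v′ (≢-sym u≢v′)) (colour-sym c (≢-sym u≢v′) u≢v)

  col-sym : ∀ u v → col u v ≡ col v u
  col-sym u v with u Fin.≟ v | v Fin.≟ u
  ... | yes _   | yes _   = refl
  ... | yes u≡v | no v≢u  = ⊥-elim (v≢u (sym u≡v))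
  ... | no u≢v  | yes v≡u = ⊥-elim (u≢v (sym v≡u))
  ... | no u≢v  | no v≢u  = colour-sym c u≢v v≢u

  IsP₈ : Fin 3 → Vec V 8 → Set
  IsP₈ i p = (∀ j k → Vec.lookup p j ≡ Vec.lookup p k → j ≡ k)
           × (∀ (j : Fin 7) → col (Vec.lookup p (inject₁ j)) (Vec.lookup p (suc j)) ≡ i)

  IsP₈? : ∀ i p → Dec (IsP₈ i p)
  IsP₈? i p =
    Fin.all? (λ j → Fin.all? λ k → (Vec.lookup p j Fin.≟ Vec.lookup p k) →-dec (j Fin.≟ k))
    ×-dec Fin.all? λ j → col (Vec.lookup p (inject₁ j)) (Vec.lookup p (suc j)) Fin.≟ i

  IsP₈⇒⊑ : ∀ {i p} → IsP₈ i p → path 8 ⊑ colourClass c i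
  IsP₈⇒⊑ {i} {p} (inj , edge) = f , inj _ _ , hom
    where
    f : Fin 8 → V
    f = Vec.lookup p
    forward : ∀ {u v} → toℕ v ≡ suc (toℕ u) → Adj (colourClass c i) (f u) (f v)
    forward {u} {suc j} eq with refl ← Fin.toℕ-injective (trans (ℕ.suc-injective (sym eq)) (sym (Fin.toℕ-inject₁ j))) =
      f≢ , trans (sym (col-colour f≢)) (edge j)
      where
      f≢ : f (inject₁ j) ≢ f (suc j)
      f≢ eq′ = ℕ.1+n≢n (trans (sym (cong toℕ (inj _ _ eq′))) (Fin.toℕ-inject₁ j))
    hom : ∀ {u v} → Adj (path 8) u v → Adj (colourClass c i) (f u) (f v)
    hom (inj₁ eq) = forward eq
    hom (inj₂ eq) = adj-sym (colourClass c i) (forward eq)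

  path⇒IsP₈ : ∀ i p → Unique p → Linked (λ u v → col u v ≡ i) p → length p ≡ 8 → ∃ (IsP₈ i)
  path⇒IsP₈ i p@(_ ∷ _ ∷ _ ∷ _ ∷ _ ∷ _ ∷ _ ∷ _ ∷ []) p! (e₀ ∷ e₁ ∷ e₂ ∷ e₃ ∷ e₄ ∷ e₅ ∷ e₆ ∷ [-]) refl =
    Vec.fromList p , (λ j k eq → lookup-injective p! (trans (sym (lookup-fromList p j)) (trans eq (lookup-fromList p k)))) , edge
    where
    lookup-fromList : ∀ (xs : List V) j → Vec.lookup (Vec.fromList xs) j ≡ lookup xs j
    lookup-fromList (_ ∷ xs) zero    = refl
    lookup-fromList (_ ∷ xs) (suc j) = lookup-fromList xs j
    edge : ∀ j → col (Vec.lookup (Vec.fromList p) (inject₁ j)) (Vec.lookup (Vec.fromList p) (suc j)) ≡ i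
    edge zero                                     = e₀
    edge (suc zero)                               = e₁
    edge (suc (suc zero))                         = e₂
    edge (suc (suc (suc zero)))                   = e₃
    edge (suc (suc (suc (suc zero))))             = e₄
    edge (suc (suc (suc (suc (suc zero)))))       = e₅
    edge (suc (suc (suc (suc (suc (suc zero)))))) = e₆

  monochromaticP₈ : ∃ λ i → path 8 ⊑ colourClass c i
  monochromaticP₈ = conclude (Fin.any? λ i → anyVec? 8 (IsP₈? i))
    where
    conclude : Dec (∃ λ i → ∃ (IsP₈ i)) → ∃ λ i → path 8 ⊑ colourClass c i
    conclude (yes (i , p , isP₈)) = i , IsP₈⇒⊑ {i} {p} isP₈
    conclude (no none) = ⊥-elim (NoMonochromaticP₈.impossible col col-sym λ i p p! link len →
      none (i , path⇒IsP₈ i p p! link len))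

theorem10 : IsRamseyNumber 3 (path 8) 14
theorem10 = UpperBound.monochromaticP₈ , λ M forces → ℕ.≰⇒> λ M≤13 → lowerBound M≤13 forces
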